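{- Let $M,N,S$ be positive integers with $M>N$, and let $Q$ denote the I/O complexity (minimum number of Load moves over all complete red-white pebble games with $S$ red pebbles) of the CDAG of the Householder QR program (V2Q part) below applied to an $M\times N$ array $A$. Then $$\frac{N (N-1)(3M-N-1)(M-N)^2}{24 ( (M-N)^2 + SM )} \leq Q .$$
   Context: Program (Householder QR, V2Q part, corresponding to LAPACK ORG2R), with input $M\times N$ array $A$ and input array $tau$ of length $N$: for k = N-1, N-2, ..., 0: for j = k+1,...,N-1: tau[j] = 0.0 for i = k+1,...,M-1: tau[j] += A[i][k]*A[i][j] for j = k+1,...,N-1: tau[j] *= tau[k] A[k][k] = 1.0 - tau[k] for j = k+1,...,N-1: A[k][j] = -tau[j] for j = k+1,...,N-1: for i = k+1,...,M-1: A[i][j] -= A[i][k]*tau[j] for i = k+1,...,M-1: A[i][k] = -A[i][k]*tau[k] CDAG of a program: a directed acyclic graph whose nodes are the input values (initial values of array entries read before being written) and the statement instances (each execution of an assignment statement, including compound assignments), with an edge $u\to v$ whenever the instance $v$ reads a value produced by $u$ (flow dependence). Input nodes have no incoming edges. Red-white pebble game with $S$ red pebbles on a CDAG: initially only the input nodes carry white pebbles and there are no red pebbles. Allowed moves: (Spill) remove a red pebble from a node; (Compute) if a node has no white pebble and all its predecessors carry red pebbles, place a white and a red pebble on it; (Load) place a red pebble on a node carrying a white pebble. At no time may more than $S$ red pebbles be on the graph. The game is complete when every node carries a white pebble. The I/O complexity $Q$ is the minimum, over all complete games, of the number of Load moves. -}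

module Defs where

open import Data.Nat using (ℕ; zero; suc; _+_; _*_; _∸_; _^_; _≤_; _<_; _≡ᵇ_)
open import Data.Bool using (Bool; true; false; if_then_else_; _∧_)
open import Data.Maybe using (Maybe; just; nothing)
open import Data.Product using (_×_; _,_)
open import Data.List using (List; []; _∷_; map; foldl; upTo; downFrom)
open import Data.Nat.ListAction using (sum)
open import Data.List.Relation.Unary.All using (All)
open import Relation.Binary.PropositionalEquality using (_≡_)
open import Function using (_∘_)

-- Generic CDAG: vertices are the natural numbers 0 .. size-1,
-- preds v lists the predecessors of v (flow-dependence sources),
-- isInput v says whether v is an input node.

record CDAG : Set where
  field
    size    : ℕ
    preds   : ℕ → List ℕ
    isInput : ℕ → Bool

-- Memory cells of the program: A[i][j] and tau[j].
data Cell : Set where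
  cA : ℕ → ℕ → Cell
  cT : ℕ → Cell

sameCell : Cell → Cell → Bool
sameCell (cA i j) (cA i' j') = (i ≡ᵇ i') ∧ (j ≡ᵇ j')
sameCell (cT j)   (cT j')    = j ≡ᵇ j'
sameCell _        _          = false

updCell : {X : Set} → (Cell → X) → Cell → X → Cell → X
updCell f c x c' = if sameCell c c' then x else f c'

updℕ : {X : Set} → (ℕ → X) → ℕ → X → ℕ → X
updℕ f v x u = if u ≡ᵇ v then x else f u

record St : Set where
  constructor mkSt
  field
    next    : ℕ
    writer  : Cell → Maybe ℕ   -- vertex (statement instance) that last wrote the cell
    inNode  : Cell → Maybe ℕ   -- input vertex holding the initial value of the cell
    predsOf : ℕ → List ℕ
    inputOf : ℕ → Bool

st₀ : St
st₀ = mkSt 0 (λ _ → nothing) (λ _ → nothing) (λ _ → []) (λ _ → false)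

-- Reading a cell: the value comes from the last writer; if the cell has
-- never been written, it is the initial value, i.e. an input node (created
-- the first time the initial value is read).
readCell : Cell → St → ℕ × St
readCell c s with St.writer s c
... | just v = v , s
... | nothing with St.inNode s c
...   | just v = v , s
...   | nothing =
        St.next s ,
        mkSt (suc (St.next s)) (St.writer s)
             (updCell (St.inNode s) c (just (St.next s)))
             (updℕ (St.predsOf s) (St.next s) [])
             (updℕ (St.inputOf s) (St.next s) true)

readCells : List Cell → St → List ℕ × St
readCells []       s = [] , s
readCells (c ∷ cs) s with readCell c s
... | v , s' with readCells cs s'
...   | vs , s'' = v ∷ vs , s''

-- One statement instance: reads the cells in `rs` (for compound
-- assignments this includes the target), writes cell `w`.
stmt : List Cell → Cell → St → St
stmt rs w s with readCells rs s
... | ps , s' =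
  mkSt (suc (St.next s'))
       (updCell (St.writer s') w (just (St.next s')))
       (St.inNode s')
       (updℕ (St.predsOf s') (St.next s') ps)
       (updℕ (St.inputOf s') (St.next s') false)

infixl 5 _⨾_
_⨾_ : (St → St) → (St → St) → St → St
(f ⨾ g) s = g (f s)

forEach : List ℕ → (ℕ → St → St) → St → St
forEach xs f s = foldl (λ s' x → f x s') s xs

range : ℕ → ℕ → List ℕ
range a b = map (a +_) (upTo (b ∸ a))

body : ℕ → ℕ → ℕ → St → St
body M N k =
  forEach (range (suc k) N) (λ j →
      stmt [] (cT j)                                           -- tau[j] = 0.0
    ⨾ forEach (range (suc k) M) (λ i →
        stmt (cT j ∷ cA i k ∷ cA i j ∷ []) (cT j)))            -- tau[j] += A[i][k]*A[i][j]
  ⨾ forEach (range (suc k) N) (λ j →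
      stmt (cT j ∷ cT k ∷ []) (cT j))                          -- tau[j] *= tau[k]
  ⨾ stmt (cT k ∷ []) (cA k k)                                  -- A[k][k] = 1.0 - tau[k]
  ⨾ forEach (range (suc k) N) (λ j →
      stmt (cT j ∷ []) (cA k j))                               -- A[k][j] = -tau[j]
  ⨾ forEach (range (suc k) N) (λ j →
      forEach (range (suc k) M) (λ i →
        stmt (cA i j ∷ cA i k ∷ cT j ∷ []) (cA i j)))          -- A[i][j] -= A[i][k]*tau[j]
  ⨾ forEach (range (suc k) M) (λ i →
      stmt (cA i k ∷ cT k ∷ []) (cA i k))                      -- A[i][k] = -A[i][k]*tau[k]

program : ℕ → ℕ → St → St
program M N = forEach (downFrom N) (body M N)

v2qCDAG : ℕ → ℕ → CDAG
v2qCDAG M N = record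
  { size    = St.next final
  ; preds   = St.predsOf final
  ; isInput = St.inputOf final
  }
  where final = program M N st₀

record Config : Set where
  constructor cfg
  field
    red   : ℕ → Bool
    white : ℕ → Bool

initConfig : CDAG → Config
initConfig G = cfg (λ _ → false) (CDAG.isInput G)

redCount : CDAG → Config → ℕ
redCount G c = sum (map (λ v → if Config.red c v then 1 else 0) (upTo (CDAG.size G)))

data Move : Set where
  spill compute load : ℕ → Move

data Step (G : CDAG) : Config → Move → Config → Set where
  spillStep : ∀ {r w v} → v < CDAG.size G → r v ≡ true →
              Step G (cfg r w) (spill v) (cfg (updℕ r v false) w)
  computeStep : ∀ {r w v} → v < CDAG.size G → w v ≡ false →
              All (λ u → r u ≡ true) (CDAG.preds G v) →
              Step G (cfg r w) (compute v) (cfg (updℕ r v true) (updℕ w v true))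
  loadStep : ∀ {r w v} → v < CDAG.size G → w v ≡ true →
              Step G (cfg r w) (load v) (cfg (updℕ r v true) w)

Complete : CDAG → Config → Set
Complete G c = All (λ v → Config.white c v ≡ true) (upTo (CDAG.size G))

data Game (G : CDAG) (S : ℕ) : Config → List Move → Set where
  done : ∀ {c} → Complete G c → Game G S c []
  step : ∀ {c m c' ms} → Step G c m c' → redCount G c' ≤ S →
         Game G S c' ms → Game G S c (m ∷ ms)

isLoad : Move → Bool
isLoad (load _) = true
isLoad _        = false

loads : List Move → ℕ
loads ms = sum (map (λ m → if isLoad m then 1 else 0) ms)

CompleteGame : CDAG → ℕ → List Move → Set
CompleteGame G S ms = Game G S (initConfig G) ms

-- The update A[i][j] -= A[i][k]*tau[j] of iteration k depends, through the scalar tau[j],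
-- on the entries A[i'][j] left by iteration k + 1 for all rows i' > k (the "hourglass").
-- Cut a game into stretches of S loads; a stretch is supplied with at most K = 2S vertices
-- from outside (K = S for the first one), and what it computes is convex in the CDAG.
-- An update whose old value of A[i][j] comes from outside is charged to that value: at
-- most K such updates.  Otherwise the end of the accumulation of tau[j] in iteration k lies
-- inside the stretch.  If it contains the rows N, …, M-1, the line (k, j) uses M - N
-- supplied vertices in column k and M - N in column j, so there are at most (K/(M-N))² such
-- lines, of at most M updates each.  The remaining updates lie below the diagonal in at
-- most one line per column j, since every later line of that column is crossed completely;
-- charging (i, j) to the vertex where its history enters the stretch bounds them by K.
-- With W = M - N, a stretch therefore performs at most 2K + K²M/W² updates, and summing over
-- the stretches gives 4(1 + SM/W²) updates per load.
module Submission where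

open import Defs
open import Data.Nat
open import Data.Nat.Properties
open import Data.Nat.ListAction using (sum)
open import Data.Nat.Tactic.RingSolver using (solve-∀)
open import Data.Bool using (Bool; true; false; if_then_else_; T)
import Data.Bool.Properties as Bool
open import Data.Empty using (⊥; ⊥-elim)
open import Data.Maybe using (Maybe; just; nothing; fromMaybe)
open import Data.Maybe.Properties using (just-injective)
open import Data.Product using (_×_; _,_; ∃-syntax; proj₁; proj₂)
open import Data.Sum using (_⊎_; inj₁; inj₂; [_,_]′)
open import Data.List using
  ( List; []; _∷_; _++_; length; map; foldl; filter; upTo; applyUpTo; downFrom
  ; concatMap; cartesianProduct; cartesianProductWith; deduplicate )
open import Data.List.Properties
open import Data.List.Membership.Propositional using (_∈_; find)
open import Data.List.Membership.Propositional.Properties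
open import Data.List.Relation.Binary.Subset.Propositional using (_⊆_)
open import Data.List.Relation.Unary.All as All using (All)
import Data.List.Relation.Unary.All.Properties as All
open import Data.List.Relation.Unary.AllPairs using ([]; _∷_)
open import Data.List.Relation.Unary.Any using (here; there)
open import Data.List.Relation.Unary.Unique.Propositional using (Unique)
import Data.List.Relation.Unary.Unique.Propositional.Properties as Unique
open import Data.List.Relation.Unary.Unique.DecPropositional.Properties using (deduplicate-!)
open import Function using (_∘_; id)
open import Relation.Binary.PropositionalEquality
open import Relation.Nullary using (Dec; yes; no; ¬_)
open import Relation.Nullary.Decidable using (_×-dec_; _⊎-dec_; ¬?)
open import Relation.Unary using (Decidable)

-- Duplicate-free lists and counting by injection

private
  variable
    A B C : Set

∈-++-swap : ∀ (as : List A) {x y bs} → y ∈ as ++ x ∷ bs → x ≢ y → y ∈ as ++ bs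
∈-++-swap as y∈ x≢y with ∈-++⁻ as y∈
... | inj₁ y∈as         = ∈-++⁺ˡ y∈as
... | inj₂ (here y≡x)   = ⊥-elim (x≢y (sym y≡x))
... | inj₂ (there y∈bs) = ∈-++⁺ʳ as y∈bs

Unique-⊆⇒length≤ : {xs ys : List A} → Unique xs → xs ⊆ ys → length xs ≤ length ys
Unique-⊆⇒length≤ {xs = []}     _        _   = z≤n
Unique-⊆⇒length≤ {xs = x ∷ xs} (x∉ ∷ u) sub with ∈-∃++ (sub (here refl))
... | as , bs , refl = begin
  suc (length xs)         ≤⟨ s≤s (Unique-⊆⇒length≤ u λ y∈ → ∈-++-swap as (sub (there y∈)) (All.lookup x∉ y∈)) ⟩
  suc (length (as ++ bs)) ≡⟨ cong suc (length-++ as) ⟩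
  suc (length as + length bs) ≡⟨ sym (+-suc (length as) (length bs)) ⟩
  length as + length (x ∷ bs) ≡⟨ sym (length-++ as) ⟩
  length (as ++ x ∷ bs)   ∎
  where open ≤-Reasoning

Unique-map : (f : A → B) {xs : List A} → (∀ {x y} → x ∈ xs → y ∈ xs → f x ≡ f y → x ≡ y) →
             Unique xs → Unique (map f xs)
Unique-map f inj []       = []
Unique-map f inj (x∉ ∷ u) =
  All.map⁺ (All.tabulate λ y∈ eq → All.lookup x∉ y∈ (inj (here refl) (there y∈) eq))
  ∷ Unique-map f (λ x∈ y∈ → inj (there x∈) (there y∈)) u

-- Both lists are compared through labels in `C`. Injectivity is asked of `f` on `xs` alone, so
-- points can be charged to vertices that are told apart only by their labels, and `ys` may repeat
-- entries.
pigeonhole : {xs : List A} {ys : List B} (f : A → C) (g : B → C) → Unique xs →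
             (∀ {x y} → x ∈ xs → y ∈ xs → f x ≡ f y → x ≡ y) →
             (∀ {x} → x ∈ xs → ∃[ y ] y ∈ ys × g y ≡ f x) →
             length xs ≤ length ys
pigeonhole {xs = xs} {ys} f g u inj hit = begin
  length xs         ≡⟨ sym (length-map f xs) ⟩
  length (map f xs) ≤⟨ Unique-⊆⇒length≤ (Unique-map f inj u) sub ⟩
  length (map g ys) ≡⟨ length-map g ys ⟩
  length ys         ∎
  where
  open ≤-Reasoning
  sub : map f xs ⊆ map g ys
  sub z∈ with ∈-map⁻ f z∈
  ... | x , x∈ , refl with hit x∈
  ...   | y , y∈ , eq = subst (_∈ map g ys) eq (∈-map⁺ g y∈)

length-filter-⊎ : {P Q R : A → Set} (P? : Decidable P) (Q? : Decidable Q) (R? : Decidable R) →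
                  (∀ x → P x → Q x ⊎ R x) → ∀ xs →
                  length (filter P? xs) ≤ length (filter Q? xs) + length (filter R? xs)
length-filter-⊎ P? Q? R? cover [] = z≤n
length-filter-⊎ P? Q? R? cover (x ∷ xs) with ih ← length-filter-⊎ P? Q? R? cover xs | P? x | Q? x | R? x
... | no _  | yes _ | yes _ = ≤-trans ih (≤-trans (n≤1+n _) (+-monoʳ-≤ (suc _) (n≤1+n _)))
... | no _  | yes _ | no _  = ≤-trans ih (n≤1+n _)
... | no _  | no _  | yes _ = ≤-trans ih (+-monoʳ-≤ (length (filter Q? xs)) (n≤1+n _))
... | no _  | no _  | no _  = ih
... | yes _ | yes _ | yes _ = s≤s (≤-trans ih (+-monoʳ-≤ (length (filter Q? xs)) (n≤1+n _)))
... | yes _ | yes _ | no _  = s≤s ih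
... | yes _ | no _  | yes _ = ≤-trans (s≤s ih) (≤-reflexive (sym (+-suc (length (filter Q? xs)) _)))
... | yes p | no ¬q | no ¬r with cover x p
...   | inj₁ q = ⊥-elim (¬q q)
...   | inj₂ r = ⊥-elim (¬r r)

dependentProduct : List A → (A → List B) → List (A × B)
dependentProduct xs f = concatMap (λ x → map (x ,_) (f x)) xs

∈-dependentProduct⁻ : ∀ xs (f : A → List B) {x y} → (x , y) ∈ dependentProduct xs f → x ∈ xs × y ∈ f x
∈-dependentProduct⁻ (x ∷ xs) f xy∈ with ∈-++⁻ (map (x ,_) (f x)) xy∈
... | inj₁ p with ∈-map⁻ (x ,_) p
...   | _ , y∈ , refl = here refl , y∈
∈-dependentProduct⁻ (x ∷ xs) f xy∈ | inj₂ p with ∈-dependentProduct⁻ xs f p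
... | x∈ , y∈ = there x∈ , y∈

Unique-dependentProduct : ∀ {xs} (f : A → List B) → Unique xs → (∀ x → Unique (f x)) →
                          Unique (dependentProduct xs f)
Unique-dependentProduct f [] uf = []
Unique-dependentProduct {xs = x ∷ xs} f (x∉ ∷ u) uf =
  Unique.++⁺ (Unique.map⁺ (λ { refl → refl }) (uf x)) (Unique-dependentProduct f u uf) disj
  where
  disj : ∀ {z} → z ∈ map (x ,_) (f x) × z ∈ dependentProduct xs f → ⊥
  disj (p , q) with ∈-map⁻ (x ,_) p
  ... | _ , _ , refl = All.lookup x∉ (proj₁ (∈-dependentProduct⁻ xs f q)) refl

length-dependentProduct : ∀ xs (f : A → List B) →
                          length (dependentProduct xs f) ≡ sum (map (length ∘ f) xs)
length-dependentProduct []       f = refl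
length-dependentProduct (x ∷ xs) f =
  trans (length-++ (map (x ,_) (f x)))
        (cong₂ _+_ (length-map (x ,_) (f x)) (length-dependentProduct xs f))

length-cartesianProduct : (xs : List A) (ys : List B) →
                          length (cartesianProduct xs ys) ≡ length xs * length ys
length-cartesianProduct []       ys = refl
length-cartesianProduct (x ∷ xs) ys =
  trans (length-++ (map (x ,_) ys)) (cong₂ _+_ (length-map (x ,_) ys) (length-cartesianProduct xs ys))

-- Loop ranges

∈-range⁺ : ∀ {a b i} → a ≤ i → i < b → i ∈ range a b
∈-range⁺ {a} {b} {i} a≤i i<b =
  subst (_∈ range a b) (m+[n∸m]≡n a≤i) (∈-map⁺ (a +_) (∈-upTo⁺ (∸-monoˡ-< i<b a≤i)))

∈-range⁻ : ∀ {a b i} → i ∈ range a b → a ≤ i × i < b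
∈-range⁻ {a} {b} i∈ with ∈-map⁻ (a +_) i∈
... | d , d∈ , refl = m≤m+n a d , m<n∸o⇒o+m<n a b (∈-upTo⁻ d∈)
  where
  m<n∸o⇒o+m<n : ∀ a b {d} → d < b ∸ a → a + d < b
  m<n∸o⇒o+m<n a b {d} d< = subst (_≤ b) (+-suc a d) (m≤n∸o⇒o+m≤n′ d<)
    where
    m≤n∸o⇒o+m≤n′ : suc d ≤ b ∸ a → a + suc d ≤ b
    m≤n∸o⇒o+m≤n′ q with ≤-total a b
    ... | inj₁ a≤b = ≤-trans (+-monoʳ-≤ a q) (≤-reflexive (m+[n∸m]≡n a≤b))
    ... | inj₂ b≤a = ⊥-elim (n≮0 (subst (suc d ≤_) (m≤n⇒m∸n≡0 b≤a) q))

Unique-range : ∀ a b → Unique (range a b)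
Unique-range a b = Unique.map⁺ (+-cancelˡ-≡ a _ _) (Unique.upTo⁺ (b ∸ a))

length-range : ∀ a b → length (range a b) ≡ b ∸ a
length-range a b = trans (length-map (a +_) (upTo (b ∸ a))) (length-upTo (b ∸ a))

-- A range given by start and length: splitting the length splits the list by plain recursion.
from : ℕ → ℕ → List ℕ
from a zero    = []
from a (suc n) = a ∷ from (suc a) n

applyUpTo≡from : ∀ f a n → (∀ x → f x ≡ a + x) → applyUpTo f n ≡ from a n
applyUpTo≡from f a zero    f≗ = refl
applyUpTo≡from f a (suc n) f≗ =
  cong₂ _∷_ (trans (f≗ 0) (+-identityʳ a))
            (applyUpTo≡from (f ∘ suc) (suc a) n λ x → trans (f≗ (suc x)) (+-suc a x))

range≡from : ∀ a b → range a b ≡ from a (b ∸ a)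
range≡from a b = trans (map-upTo (a +_) (b ∸ a)) (applyUpTo≡from (a +_) a (b ∸ a) λ _ → refl)

from-++ : ∀ a m n → from a (m + n) ≡ from a m ++ from (a + m) n
from-++ a zero    n = cong (λ b → from b n) (sym (+-identityʳ a))
from-++ a (suc m) n = cong (a ∷_) (trans (from-++ (suc a) m n)
  (cong (λ b → from (suc a) m ++ from b n) (sym (+-suc a m))))

-- Cuts a loop at the iteration `i`, so that the program states before and after it can be named.
range-split : ∀ {a i b} → a ≤ i → i < b → range a b ≡ range a i ++ i ∷ range (suc i) b
range-split {a} {i} {b} a≤i i<b with m≤n⇒∃[o]m+o≡n a≤i | m≤n⇒∃[o]m+o≡n i<b
... | m , refl | n , refl = begin
  range a (suc (a + m + n))                             ≡⟨ range≡from a _ ⟩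
  from a (suc (a + m + n) ∸ a)                          ≡⟨ cong (from a) len ⟩
  from a (m + suc n)                                    ≡⟨ from-++ a m (suc n) ⟩
  from a m ++ a + m ∷ from (suc (a + m)) n
    ≡⟨ cong₂ (λ xs ys → xs ++ a + m ∷ ys) (sym (range-+ a m)) (sym (range-+ (suc (a + m)) n)) ⟩
  range a (a + m) ++ a + m ∷ range (suc (a + m)) (suc (a + m) + n) ∎
  where
  open ≡-Reasoning
  range-+ : ∀ a m → range a (a + m) ≡ from a m
  range-+ a m = trans (range≡from a (a + m)) (cong (from a) (m+n∸m≡n a m))
  len : suc (a + m + n) ∸ a ≡ m + suc n
  len = trans (cong (_∸ a) (trans (sym (+-suc (a + m) n)) (+-assoc a m (suc n)))) (m+n∸m≡n a (m + suc n))

range-empty : ∀ a → range a a ≡ []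
range-empty a = cong (λ n → map (a +_) (upTo n)) (n∸n≡0 a)

range-snoc : ∀ {a i} → a ≤ i → range a (suc i) ≡ range a i ++ i ∷ []
range-snoc {a} {i} a≤i = trans (range-split a≤i ≤-refl) (cong (λ xs → range a i ++ i ∷ xs) (range-empty (suc i)))

-- Counting the updates performed between two moments of a game

true≢false : ∀ {b : Bool} {A : Set} → b ≡ true → b ≡ false → A
true≢false refl ()

-- The point `(k , j , i)` stands for the update `V k i j`; its coordinates follow the loop nest, so
-- the last two are swapped.
Point : Set
Point = ℕ × ℕ × ℕ

points : ℕ → ℕ → List Point
points M N = dependentProduct (upTo N) (λ k → cartesianProduct (range (suc k) N) (range (suc k) M))

Unique-points : ∀ M N → Unique (points M N)
Unique-points M N = Unique-dependentProduct _ (Unique.upTo⁺ N)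
  (λ k → Unique.cartesianProduct⁺ (Unique-range (suc k) N) (Unique-range (suc k) M))

record InRange (M N k i j : ℕ) : Set where
  constructor inRange
  field
    k<i : k < i
    i<M : i < M
    k<j : k < j
    j<N : j < N

∈-points : ∀ {M N k j i} → (k , j , i) ∈ points M N → InRange M N k i j
∈-points {M} {N} {k} p∈ with ∈-dependentProduct⁻ (upTo N) _ p∈
... | _ , ji∈ with ∈-cartesianProduct⁻ (range (suc k) N) (range (suc k) M) ji∈
...   | j∈ , i∈ with ∈-range⁻ j∈ | ∈-range⁻ i∈
...     | k<j , j<N | k<i , i<M = inRange k<i i<M k<j j<N

-- V k i j is the vertex holding A[i][j] after iteration k, so that V k i j with
-- k < i, k < j is the update A[i][j] -= A[i][k]*tau[j]; sr k i j and st k j are the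
-- accumulation and the scaling of tau[j] in iteration k; inp i k is the input A[i][k].
-- A label records the iteration (0 for inputs) and the cell.
record Hourglass (G : CDAG) (M N : ℕ) : Set where
  open CDAG G
  field
    V sr    : ℕ → ℕ → ℕ → ℕ
    st inp  : ℕ → ℕ → ℕ
    lab     : ℕ → ℕ × Cell
    V-prev  : ∀ {k i j} → InRange M N k i j → V (suc k) i j ∈ preds (V k i j)
    V-st    : ∀ {k i j} → InRange M N k i j → st k j ∈ preds (V k i j)
    st-sr   : ∀ {k i j} → InRange M N k i j → suc i ≡ M → sr k i j ∈ preds (st k j)
    sr-prev : ∀ {k i j} → InRange M N k i j → suc i < M → sr k i j ∈ preds (sr k (suc i) j)
    sr-V    : ∀ {k i j} → InRange M N k i j → V (suc k) i j ∈ preds (sr k i j)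
    sr-inp  : ∀ {k i j} → InRange M N k i j → inp i k ∈ preds (sr k i j)
    V-inp   : ∀ {k i} → k < i → i < M → k < N → inp i k ∈ preds (V k i k)
    inp-isInput : ∀ {k i} → k < i → i < M → k < N → isInput (inp i k) ≡ true
    V-isInput   : ∀ {k i j} → InRange M N k i j → isInput (V k i j) ≡ false
    V-size  : ∀ {k i j} → InRange M N k i j → V k i j < size
    lab-V   : ∀ {k i j} → k ≤ i → i < M → k ≤ j → j < N → lab (V k i j) ≡ (k , cA i j)
    lab-inp : ∀ {k i} → k < i → i < M → k < N → proj₂ (lab (inp i k)) ≡ cA i k
    input-preds : ∀ {v} → isInput v ≡ true → preds v ≡ []

Closed : CDAG → (ℕ → Bool) → Set
Closed G w = ∀ {v u} → u ∈ CDAG.preds G v → w v ≡ true → w u ≡ true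

module Segments {G : CDAG} {M N : ℕ} (N<M : N < M) (H : Hourglass G M N) where
  open CDAG G
  open Hourglass H

  module _ {w : ℕ → Bool} (closed : Closed G w) where

    -- The accumulations of tau[j] in iteration `k` form a chain through the rows.
    sr-closed : ∀ {k i i' j} → InRange M N k i j → i ≤′ i' → i' < M → w (sr k i' j) ≡ true → w (sr k i j) ≡ true
    sr-closed r ≤′-refl i'<M d = d
    sr-closed r@(inRange k<i i<M k<j j<N) (≤′-step {n} i≤n) i'<M d =
      sr-closed r i≤n (<-trans (n<1+n n) i'<M)
        (closed (sr-prev (inRange (<-≤-trans k<i (≤′⇒≤ i≤n)) (<-trans (n<1+n n) i'<M) k<j j<N) i'<M) d)

    -- The scaling reads the accumulation at row `M - 1`, the end of the chain, and so depends on
    -- every row.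
    st-closed : ∀ {k i j} → InRange M N k i j → w (st k j) ≡ true → w (sr k i j) ≡ true
    st-closed {i = i} r@(inRange k<i i<M k<j j<N) d with m≤n⇒∃[o]m+o≡n i<M
    -- Here `M = suc (i + o)`, so `i + o` is the last row.
    ... | o , refl = sr-closed r (≤⇒≤′ (m≤m+n i o)) ≤-refl
                       (closed (st-sr (inRange (<-≤-trans k<i (m≤m+n i o)) ≤-refl k<j j<N) refl) d)

    -- The neck of the hourglass: an update reads the scaled tau[j], hence depends on the
    -- accumulation at every row `i'`.
    V-closed : ∀ {k i i' j} → InRange M N k i j → InRange M N k i' j →
               w (V k i j) ≡ true → w (sr k i' j) ≡ true
    V-closed r r' d = st-closed r' (closed (V-st r) d)

    -- Iterations run downwards, so `k' ≤ k` means that `k` comes first. Each step goes from the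
    -- scaling in iteration `n` through `sr n N j` and `V (suc n) N j` to the scaling in iteration
    -- `suc n`. Row `N` serves as witness: it exceeds every iteration index and exists by `N<M`.
    st-closed* : ∀ {k k' j} → k' ≤′ k → k < j → j < N → w (st k' j) ≡ true → w (st k j) ≡ true
    st-closed* ≤′-refl k<j j<N d = d
    st-closed* (≤′-step {n} k'≤n) sn<j j<N d = closed (V-st r') (closed (sr-V r) (st-closed r (st-closed* k'≤n n<j j<N d)))
      where
      n<j = <-trans (n<1+n n) sn<j
      r' : InRange M N (suc n) N _
      r' = inRange (<-trans sn<j j<N) N<M sn<j j<N
      r : InRange M N n N _
      r = inRange (<-trans n<j j<N) N<M n<j j<N

  -- `wa` and `wb` are the white sets at the start and at the end of a stretch of moves; `R`
  -- collects the vertices supplied from outside.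
  record Segment (wa wb : ℕ → Bool) (R : List ℕ) : Set where
    field
      wa-closed : Closed G wa
      wb-closed : Closed G wb
      wa-input  : ∀ {v} → isInput v ≡ true → wa v ≡ true
      supplied  : ∀ {v u} → u ∈ preds v → wb v ≡ true → wa v ≡ false →
                  (wb u ≡ true × wa u ≡ false) ⊎ u ∈ R

  pending : (ℕ → Bool) → List Point
  pending w = filter (λ { (k , j , i) → w (V k i j) Bool.≟ false }) (points M N)

  module _ {wa wb : ℕ → Bool} {R : List ℕ} (seg : Segment wa wb R) where
    open Segment seg

    E : ℕ → Set
    E v = wb v ≡ true × wa v ≡ false

    E? : Decidable E
    E? v = (wb v Bool.≟ true) ×-dec (wa v Bool.≟ false)

    reflects : ∀ {u v} → (wa v ≡ true → wa u ≡ true) → wa u ≡ false → wa v ≡ false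
    reflects {u} {v} f eq with wa v
    ... | false = refl
    ... | true  = true≢false (f refl) eq

    -- Row `N` is the first of the `M - N` rows that no iteration index reaches. With `sr k N j` and
    -- `st k j` both in the segment, convexity puts the accumulations at all these rows inside it.
    Heavyₗ : ℕ → ℕ → Set
    Heavyₗ k j = E (sr k N j) × E (st k j)

    Heavyₗ? : ∀ k j → Dec (Heavyₗ k j)
    Heavyₗ? k j = E? (sr k N j) ×-dec E? (st k j)

    Done Fresh Heavy Light : Point → Set
    Done  (k , j , i) = E (V k i j)
    Fresh (k , j , i) = E (V k i j) × ¬ E (V (suc k) i j)
    Heavy (k , j , i) = Heavyₗ k j
    Light (k , j , i) = E (V k i j) × E (V (suc k) i j) × ¬ Heavyₗ k j

    Done? : Decidable Done
    Done? (k , j , i) = E? (V k i j)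

    Fresh? : Decidable Fresh
    Fresh? (k , j , i) = E? (V k i j) ×-dec ¬? (E? (V (suc k) i j))

    Heavy? : Decidable Heavy
    Heavy? (k , j , i) = Heavyₗ? k j

    Light? : Decidable Light
    Light? (k , j , i) = E? (V k i j) ×-dec E? (V (suc k) i j) ×-dec ¬? (Heavyₗ? k j)

    -- The old value is read from outside, hence lies in `R`, and its label `(suc k , cA i j)`
    -- recovers the point.
    fresh-bound : length (filter Fresh? (points M N)) ≤ length R
    fresh-bound = pigeonhole f lab (Unique.filter⁺ Fresh? (Unique-points M N)) (λ _ _ → f-injective) hit
      where
      f : Point → ℕ × Cell
      f (k , j , i) = suc k , cA i j
      f-injective : ∀ {p q} → f p ≡ f q → p ≡ q
      f-injective refl = refl
      hit : ∀ {p} → p ∈ filter Fresh? (points M N) → ∃[ r ] r ∈ R × lab r ≡ f p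
      hit {k , j , i} p∈ with ∈-filter⁻ Fresh? {xs = points M N} p∈
      ... | p∈pts , (eb , ea) , ¬E with ∈-points p∈pts
      ...   | r@(inRange k<i i<M k<j j<N) with supplied (V-prev r) eb ea
      ...     | inj₁ e  = ⊥-elim (¬E e)
      ...     | inj₂ ∈R = V (suc k) i j , ∈R , lab-V k<i i<M k<j j<N

    supplied-inp : ∀ {k i v} → k < i → i < M → k < N → inp i k ∈ preds v → E v → inp i k ∈ R
    supplied-inp k<i i<M k<N ∈v (eb , ea) with supplied ∈v eb ea
    ... | inj₂ ∈R       = ∈R
    ... | inj₁ (_ , ea') = true≢false (wa-input (inp-isInput k<i i<M k<N)) ea'

    -- The values of A[i][j] are followed back through iterations `k`, `k + 1`, ..., `j` until one
    -- lies in `R`. Below the diagonal the chain ends at `V j i j`, which reads the input A[i][j];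
    -- inputs are white from the start, so this one can only come from `R`.
    chain-root : ∀ {k i j} → k ≤′ j → j < i → i < M → j < N → E (V k i j) ⊎ V k i j ∈ R →
                 ∃[ r ] r ∈ R × proj₂ (lab r) ≡ cA i j
    chain-root {k} {i} {j} k≤j j<i i<M j<N = go (j ∸ k) k (m+[n∸m]≡n (≤′⇒≤ k≤j))
      where
      go : ∀ d k → k + d ≡ j → E (V k i j) ⊎ V k i j ∈ R → ∃[ r ] r ∈ R × proj₂ (lab r) ≡ cA i j
      go d k eq (inj₂ ∈R) = _ , ∈R , cong proj₂ (lab-V (≤-trans k≤ (<⇒≤ j<i)) i<M k≤ j<N)
        where
        k≤ : k ≤ j
        k≤ = subst (k ≤_) eq (m≤m+n k d)
      go zero    k eq (inj₁ e) with trans (sym (+-identityʳ k)) eq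
      ... | refl = _ , supplied-inp j<i i<M j<N (V-inp j<i i<M j<N) e , lab-inp j<i i<M j<N
      go (suc d) k eq (inj₁ e@(eb , ea)) =
        go d (suc k) (trans (sym (+-suc k d)) eq) (supplied (V-prev r) eb ea)
        where
        k< : k < j
        k< = subst (k <_) eq (m<m+n k (s≤s z≤n))
        r : InRange M N k i j
        r = inRange (<-trans k< j<i) i<M k< j<N

    -- For `i ≤ N` the accumulation at row `N` comes after the one at row `i`, which reads the value
    -- `V (suc k) i j` computed in the segment. Then `sr k N j` and `st k j` are computed in the
    -- segment too, and the line is heavy.
    light-row : ∀ {k i j} → InRange M N k i j → Light (k , j , i) → N < i
    light-row {k} {i} {j} r@(inRange k<i i<M k<j j<N) ((eb , _) , (_ , fa) , ¬heavy) with i ≤? N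
    ... | no i≰N  = ≰⇒> i≰N
    ... | yes i≤N = ⊥-elim (¬heavy ((V-closed wb-closed r rN eb ,
                                      reflects closed-sr fa)
                                   , (wb-closed (V-st r) eb , reflects (λ d → closed-sr (st-closed wa-closed rN d)) fa)))
      where
      rN : InRange M N k N j
      rN = inRange (<-trans k<j j<N) N<M k<j j<N
      closed-sr : wa (sr k N j) ≡ true → wa (V (suc k) i j) ≡ true
      closed-sr d = wa-closed (sr-V r) (sr-closed wa-closed r (≤⇒≤′ i≤N) N<M d)

    -- The part of column j between two lines k' < k that both continue inside the
    -- segment passes through every row of the line k'.
    light-lines : ∀ {k k' i i' j} → InRange M N k i j → InRange M N k' i' j →
                  Light (k , j , i) → Light (k' , j , i') → ¬ k' < k
    light-lines {k} {k'} {i} {i'} {j} r r' (_ , (_ , fa) , _) ((eb , _) , _ , ¬heavy) k'<k =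
      ¬heavy ((V-closed wb-closed r' rN eb , reflects (λ d → via-st (wa-closed (V-st rN') (wa-closed (sr-V rN) d))) fa)
             , (wb-closed (V-st r') eb ,
                reflects (λ d → via-st (st-closed* wa-closed (≤⇒≤′ (n≤1+n k')) sk'<j j<N d)) fa))
      where
      open InRange r using (k<j; j<N)
      sk'<j = ≤-<-trans k'<k k<j
      rN : InRange M N k' N j
      rN = inRange (<-trans k'<k (<-trans k<j j<N)) N<M (<-trans k'<k k<j) j<N
      rN' : InRange M N (suc k') N j
      rN' = inRange (<-trans sk'<j j<N) N<M sk'<j j<N
      via-st : wa (st (suc k') j) ≡ true → wa (V (suc k) i j) ≡ true
      via-st d = wa-closed (sr-V r) (st-closed wa-closed r (st-closed* wa-closed (≤⇒≤′ k'<k) k<j j<N d))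

    -- By `light-lines` the cell of a light point determines its iteration, so each light point can
    -- be charged to its cell alone.
    light-bound : length (filter Light? (points M N)) ≤ length R
    light-bound = pigeonhole f (proj₂ ∘ lab) (Unique.filter⁺ Light? (Unique-points M N)) f-injective hit
      where
      f : Point → Cell
      f (k , j , i) = cA i j
      f-injective : ∀ {p q} → p ∈ filter Light? (points M N) → q ∈ filter Light? (points M N) → f p ≡ f q → p ≡ q
      f-injective {k , j , i} {k' , _ , _} p∈ q∈ refl
        with ∈-filter⁻ Light? {xs = points M N} p∈ | ∈-filter⁻ Light? {xs = points M N} q∈
      ... | p∈pts , lp | q∈pts , lq =
        cong (_, j , i) (≤-antisym (≮⇒≥ (light-lines rp rq lp lq)) (≮⇒≥ (light-lines rq rp lq lp)))
        where
        rp = ∈-points p∈pts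
        rq = ∈-points q∈pts
      hit : ∀ {p} → p ∈ filter Light? (points M N) → ∃[ r ] r ∈ R × proj₂ (lab r) ≡ f p
      hit {k , j , i} p∈ with ∈-filter⁻ Light? {xs = points M N} p∈
      ... | p∈pts , lp@(_ , e , _) with ∈-points p∈pts
      ...   | r@(inRange k<i i<M k<j j<N) =
        -- `light-row` gives `j < N < i`, so the cell lies below the diagonal.
        chain-root (≤⇒≤′ k<j) (<-trans j<N (light-row r lp)) i<M j<N (inj₁ e)

    heavy-sr : ∀ {k i j} → k < j → j < N → N ≤ i → i < M → Heavyₗ k j → E (sr k i j)
    heavy-sr k<j j<N N≤i i<M ((_ , sa) , (tb , _)) =
      st-closed wb-closed r tb , reflects (sr-closed wa-closed rN (≤⇒≤′ N≤i) i<M) sa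
      where
      rN = inRange (<-trans k<j j<N) N<M k<j j<N
      r = inRange (<-≤-trans (<-trans k<j j<N) N≤i) i<M k<j j<N

    heavies : List Point
    heavies = filter Heavy? (points M N)

    -- The two projections of the set of heavy lines `(k , j)`; the product of their sizes bounds
    -- the number of these lines.
    lines columns : List ℕ
    lines   = deduplicate _≟_ (map proj₁ heavies)
    columns = deduplicate _≟_ (map (proj₁ ∘ proj₂) heavies)

    -- For each such `k`, accumulations inside the segment read the inputs A[i][k] of the rows `N`
    -- to `M - 1`. Inputs are never computed, so all of them lie in `R`, and different pairs
    -- `(k , i)` give different cells.
    lines-bound : length lines * (M ∸ N) ≤ length R
    lines-bound = subst (_≤ length R)
      (trans (length-cartesianProduct lines (range N M)) (cong (length lines *_) (length-range N M)))
      (pigeonhole f (proj₂ ∘ lab)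
        (Unique.cartesianProduct⁺ (deduplicate-! _≟_ (map proj₁ heavies)) (Unique-range N M)) (λ _ _ → f-injective) hit)
      where
      f : ℕ × ℕ → Cell
      f (k , i) = cA i k
      f-injective : ∀ {p q} → f p ≡ f q → p ≡ q
      f-injective refl = refl
      hit : ∀ {p} → p ∈ cartesianProduct lines (range N M) → ∃[ r ] r ∈ R × proj₂ (lab r) ≡ f p
      hit {k , i} p∈ with ∈-cartesianProduct⁻ lines (range N M) p∈
      ... | k∈ , i∈ with ∈-map⁻ proj₁ (∈-deduplicate⁻ _≟_ (map proj₁ heavies) k∈) | ∈-range⁻ i∈
      ...   | (.k , j , _) , h∈ , refl | N≤i , i<M with ∈-filter⁻ Heavy? {xs = points M N} h∈
      ...     | h∈pts , h with ∈-points {M} {N} h∈pts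
      ...       | inRange _ _ k<j j<N =
        inp i k , supplied-inp k<i i<M k<N (sr-inp (inRange k<i i<M k<j j<N)) (heavy-sr k<j j<N N≤i i<M h)
                , lab-inp k<i i<M k<N
        where
        k<N = <-trans k<j j<N
        k<i = <-≤-trans k<N N≤i

    -- The other factor of the same products: the accumulation at row `i` reads `V (suc k) i j`,
    -- whose history leads to a vertex of `R` belonging to the cell `cA i j`.
    columns-bound : length columns * (M ∸ N) ≤ length R
    columns-bound = subst (_≤ length R)
      (trans (length-cartesianProduct columns (range N M)) (cong (length columns *_) (length-range N M)))
      (pigeonhole f (proj₂ ∘ lab)
        (Unique.cartesianProduct⁺ (deduplicate-! _≟_ (map (proj₁ ∘ proj₂) heavies)) (Unique-range N M))
        (λ _ _ → f-injective) hit)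
      where
      f : ℕ × ℕ → Cell
      f (j , i) = cA i j
      f-injective : ∀ {p q} → f p ≡ f q → p ≡ q
      f-injective refl = refl
      hit : ∀ {p} → p ∈ cartesianProduct columns (range N M) → ∃[ r ] r ∈ R × proj₂ (lab r) ≡ f p
      hit {j , i} p∈ with ∈-cartesianProduct⁻ columns (range N M) p∈
      ... | j∈ , i∈ with ∈-map⁻ (proj₁ ∘ proj₂) (∈-deduplicate⁻ _≟_ (map (proj₁ ∘ proj₂) heavies) j∈) | ∈-range⁻ i∈
      ...   | (k , .j , _) , h∈ , refl | N≤i , i<M with ∈-filter⁻ Heavy? {xs = points M N} h∈
      ...     | h∈pts , h with ∈-points {M} {N} h∈pts
      ...       | inRange _ _ k<j j<N with heavy-sr k<j j<N N≤i i<M h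
      ...         | eb , ea = chain-root (≤⇒≤′ k<j) (<-≤-trans j<N N≤i) i<M j<N
                                (supplied (sr-V (inRange (<-≤-trans (<-trans k<j j<N) N≤i) i<M k<j j<N)) eb ea)

    heavies-cover : length heavies ≤ length lines * (length columns * M)
    heavies-cover = begin
      length heavies ≤⟨ Unique-⊆⇒length≤ (Unique.filter⁺ Heavy? (Unique-points M N)) sub ⟩
      length (cartesianProduct lines (cartesianProduct columns (upTo M)))
        ≡⟨ length-cartesianProduct lines _ ⟩
      length lines * length (cartesianProduct columns (upTo M))
        ≡⟨ cong (length lines *_) (trans (length-cartesianProduct columns (upTo M)) (cong (length columns *_) (length-upTo M))) ⟩
      length lines * (length columns * M) ∎
      where
      open ≤-Reasoning
      sub : heavies ⊆ cartesianProduct lines (cartesianProduct columns (upTo M))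
      sub p∈ = ∈-cartesianProduct⁺ (∈-deduplicate⁺ _≟_ (∈-map⁺ proj₁ p∈))
        (∈-cartesianProduct⁺ (∈-deduplicate⁺ _≟_ (∈-map⁺ (proj₁ ∘ proj₂) p∈))
          (∈-upTo⁺ (InRange.i<M (∈-points {M} {N} (proj₁ (∈-filter⁻ Heavy? {xs = points M N} p∈))))))

    heavy-bound : length heavies * (M ∸ N) ^ 2 ≤ length R ^ 2 * M
    heavy-bound = begin
      length heavies * W ^ 2           ≤⟨ *-monoˡ-≤ (W ^ 2) heavies-cover ⟩
      a * (b * M) * W ^ 2              ≡⟨ rearrange a b M W ⟩
      (a * W) * (b * W) * M            ≤⟨ *-monoˡ-≤ M (*-mono-≤ lines-bound columns-bound) ⟩
      length R * length R * M          ≡⟨ cong (λ x → length R * x * M) (sym (*-identityʳ (length R))) ⟩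
      length R ^ 2 * M                 ∎
      where
      open ≤-Reasoning
      W = M ∸ N
      a = length lines
      b = length columns
      rearrange : ∀ a b m w → a * (b * m) * (w * (w * 1)) ≡ (a * w) * (b * w) * m
      rearrange = solve-∀

    classify : ∀ p → Done p → Fresh p ⊎ (Heavy p ⊎ Light p)
    classify (k , j , i) e with E? (V (suc k) i j) | Heavyₗ? k j
    ... | no ¬f | _     = inj₁ (e , ¬f)
    ... | yes f | yes h = inj₂ (inj₁ h)
    ... | yes f | no ¬h = inj₂ (inj₂ (e , f , ¬h))

    segment-bound : length (filter Done? (points M N)) * (M ∸ N) ^ 2 ≤
                    2 * length R * (M ∸ N) ^ 2 + length R ^ 2 * M
    segment-bound = begin
      length (filter Done? ps) * W²
        ≤⟨ *-monoˡ-≤ W² (length-filter-⊎ Done? Fresh? HL? classify ps) ⟩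
      (length (filter Fresh? ps) + length (filter HL? ps)) * W²
        ≤⟨ *-monoˡ-≤ W² (+-mono-≤ fresh-bound
             (≤-trans (length-filter-⊎ HL? Heavy? Light? (λ _ → id) ps) (+-monoʳ-≤ (length heavies) light-bound))) ⟩
      (length R + (length heavies + length R)) * W²
        ≡⟨ rearrange (length R) (length heavies) W² ⟩
      2 * length R * W² + length heavies * W²
        ≤⟨ +-monoʳ-≤ (2 * length R * W²) heavy-bound ⟩
      2 * length R * W² + length R ^ 2 * M ∎
      where
      open ≤-Reasoning
      ps = points M N
      W² = (M ∸ N) ^ 2
      HL? : Decidable (λ p → Heavy p ⊎ Light p)
      HL? p = Heavy? p ⊎-dec Light? p
      rearrange : ∀ r h w → (r + (h + r)) * w ≡ 2 * r * w + h * w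
      rearrange = solve-∀

    -- Phrased with the points still to be computed, so that the bounds of consecutive segments
    -- telescope.
    pending-bound : length (pending wa) * (M ∸ N) ^ 2 ≤
                    2 * length R * (M ∸ N) ^ 2 + length R ^ 2 * M + length (pending wb) * (M ∸ N) ^ 2
    pending-bound = begin
      length (pending wa) * W² ≤⟨ *-monoˡ-≤ W² (length-filter-⊎ _ Done? _ split (points M N)) ⟩
      (length (filter Done? (points M N)) + length (pending wb)) * W²
        ≡⟨ *-distribʳ-+ W² (length (filter Done? (points M N))) (length (pending wb)) ⟩
      length (filter Done? (points M N)) * W² + length (pending wb) * W²
        ≤⟨ +-monoˡ-≤ (length (pending wb) * W²) segment-bound ⟩
      2 * length R * W² + length R ^ 2 * M + length (pending wb) * W² ∎
      where
      open ≤-Reasoning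
      W² = (M ∸ N) ^ 2
      split : ∀ p → wa (V (proj₁ p) (proj₂ (proj₂ p)) (proj₁ (proj₂ p))) ≡ false →
              Done p ⊎ wb (V (proj₁ p) (proj₂ (proj₂ p)) (proj₁ (proj₂ p))) ≡ false
      split (k , j , i) ea with wb (V k i j) in eq
      ... | true  = inj₁ (refl , ea)
      ... | false = inj₂ refl

-- Pebble games

updℕ-self : ∀ {X : Set} (f : ℕ → X) v x → updℕ f v x v ≡ x
updℕ-self f v x with v ≡ᵇ v | ≡⇒≡ᵇ v v refl
... | true | _ = refl

updℕ-other : ∀ {X : Set} (f : ℕ → X) {v u} x → u ≢ v → updℕ f v x u ≡ f u
updℕ-other f {v} {u} x u≢v with u ≡ᵇ v in eq
... | false = refl
... | true  = ⊥-elim (u≢v (≡ᵇ⇒≡ u v (subst T (sym eq) _)))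

updℕ-true⁻ : ∀ f {v u} → updℕ f v true u ≡ true → u ≡ v ⊎ f u ≡ true
updℕ-true⁻ f {v} {u} eq with u ≟ v
... | yes u≡v = inj₁ u≡v
... | no  u≢v = inj₂ (trans (sym (updℕ-other f true u≢v)) eq)

updℕ-true⁺ : ∀ f v {u} → f u ≡ true → updℕ f v true u ≡ true
updℕ-true⁺ f v {u} eq with u ≟ v
... | yes refl = updℕ-self f v true
... | no  u≢v  = trans (updℕ-other f true u≢v) eq

updℕ-false⁻ : ∀ f {v u} → updℕ f v false u ≡ true → f u ≡ true
updℕ-false⁻ f {v} {u} eq with u ≟ v
... | yes refl = true≢false eq (updℕ-self f v false)
... | no  u≢v  = trans (sym (updℕ-other f false u≢v)) eq

-- Since red vertices are white, a vertex can turn white only after its predecessors; this yields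
-- the closedness required at both ends of a segment.
record Valid (G : CDAG) (c : Config) : Set where
  open CDAG G
  open Config c
  field
    red-size     : ∀ {v} → red v ≡ true → v < size
    red-white    : ∀ {v} → red v ≡ true → white v ≡ true
    input-white  : ∀ {v} → isInput v ≡ true → white v ≡ true
    white-closed : Closed G white

step-valid : ∀ {G c m c'} → Step G c m c' → Valid G c → Valid G c'
step-valid (spillStep {r} {w} {v} _ _) val = record
  { red-size     = λ e → red-size (updℕ-false⁻ r e)
  ; red-white    = λ e → red-white (updℕ-false⁻ r e)
  ; input-white  = input-white
  ; white-closed = white-closed }
  where open Valid val
step-valid {G} (computeStep {r} {w} {v} v<size _ preds-red) val = record
  { red-size     = λ e → [ (λ { refl → v<size }) , red-size ]′ (updℕ-true⁻ r e)
  ; red-white    = λ e → [ (λ { refl → updℕ-self w v true }) , (λ e' → updℕ-true⁺ w v (red-white e')) ]′ (updℕ-true⁻ r e)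
  ; input-white  = λ e → updℕ-true⁺ w v (input-white e)
  ; white-closed = λ u∈ e → updℕ-true⁺ w v
      ([ (λ { refl → red-white (All.lookup preds-red u∈) }) , white-closed u∈ ]′ (updℕ-true⁻ w e)) }
  where
  open Valid val
step-valid (loadStep {r} {w} {v} v<size v-white) val = record
  { red-size     = λ e → [ (λ { refl → v<size }) , red-size ]′ (updℕ-true⁻ r e)
  ; red-white    = λ e → [ (λ { refl → v-white }) , red-white ]′ (updℕ-true⁻ r e)
  ; input-white  = input-white
  ; white-closed = white-closed }
  where
  open Valid val

redList : CDAG → Config → List ℕ
redList G c = filter (λ v → Config.red c v Bool.≟ true) (upTo (CDAG.size G))

length-redList : ∀ G c → length (redList G c) ≡ redCount G c
length-redList G c = go (upTo (CDAG.size G))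
  where
  go : ∀ xs → length (filter (λ v → Config.red c v Bool.≟ true) xs) ≡
              sum (map (λ v → if Config.red c v then 1 else 0) xs)
  go [] = refl
  go (x ∷ xs) with Config.red c x
  ... | true  = cong suc (go xs)
  ... | false = go xs

-- wa is the white set at the start of the current stretch of moves, and R lists
-- the vertices that were red at that time or have been loaded since.
record Window (G : CDAG) (wa : ℕ → Bool) (R : List ℕ) (c : Config) : Set where
  open CDAG G
  open Config c
  field
    wa-white  : ∀ {v} → wa v ≡ true → white v ≡ true
    available : ∀ {v} → red v ≡ true → (white v ≡ true × wa v ≡ false) ⊎ v ∈ R
    supplied  : ∀ {v u} → u ∈ preds v → white v ≡ true → wa v ≡ false →
                (white u ≡ true × wa u ≡ false) ⊎ u ∈ R

spill-window : ∀ {G wa R c v c'} → Step G c (spill v) c' → Window G wa R c → Window G wa R c'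
spill-window (spillStep {r} _ _) win = record
  { wa-white = wa-white ; available = λ e → available (updℕ-false⁻ r e) ; supplied = supplied }
  where open Window win

-- The computed vertex was not white, so it lies outside `wa`; its predecessors are red, so
-- `available` accounts for them and gives the new instance of `supplied`.
compute-window : ∀ {G wa R c v c'} → Step G c (compute v) c' → Window G wa R c → Window G wa R c'
compute-window {G} {wa} {R} (computeStep {r} {w} {v} _ v-fresh preds-red) win = record
  { wa-white = λ e → updℕ-true⁺ w v (wa-white e) ; available = available' ; supplied = supplied' }
  where
  open Window win
  fresh : wa v ≡ false
  fresh with wa v in eq
  ... | false = refl
  ... | true  = true≢false (wa-white eq) v-fresh
  grow : ∀ {u} → (w u ≡ true × wa u ≡ false) ⊎ u ∈ R → (updℕ w v true u ≡ true × wa u ≡ false) ⊎ u ∈ R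
  grow (inj₁ (e , a)) = inj₁ (updℕ-true⁺ w v e , a)
  grow (inj₂ ∈R)      = inj₂ ∈R
  available' : ∀ {u} → updℕ r v true u ≡ true → (updℕ w v true u ≡ true × wa u ≡ false) ⊎ u ∈ R
  available' e with updℕ-true⁻ r e
  ... | inj₁ refl = inj₁ (updℕ-self w v true , fresh)
  ... | inj₂ e'   = grow (available e')
  supplied' : ∀ {x u} → u ∈ CDAG.preds G x → updℕ w v true x ≡ true → wa x ≡ false →
              (updℕ w v true u ≡ true × wa u ≡ false) ⊎ u ∈ R
  supplied' u∈ e a with updℕ-true⁻ w e
  ... | inj₁ refl = grow (available (All.lookup preds-red u∈))
  ... | inj₂ e'   = grow (supplied u∈ e' a)

load-window : ∀ {G wa R c v c'} → Step G c (load v) c' → Window G wa R c → Window G wa (v ∷ R) c'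
load-window {G} {wa} {R} (loadStep {r} {w} {v} _ _) win = record
  { wa-white = wa-white ; available = available' ; supplied = λ u∈ e a → weaken (supplied u∈ e a) }
  where
  open Window win
  weaken : ∀ {A : Set} {u} → A ⊎ u ∈ R → A ⊎ u ∈ v ∷ R
  weaken (inj₁ a)  = inj₁ a
  weaken (inj₂ ∈R) = inj₂ (there ∈R)
  available' : ∀ {u} → updℕ r v true u ≡ true → (w u ≡ true × wa u ≡ false) ⊎ u ∈ v ∷ R
  available' e with updℕ-true⁻ r e
  ... | inj₁ refl = inj₂ (here refl)
  ... | inj₂ e'   = weaken (available e')

new-window : ∀ {G c} → Valid G c → Window G (Config.white c) (redList G c) c
new-window {G} {c} val = record
  { wa-white  = id
  ; available = λ e → inj₂ (∈-filter⁺ _ (∈-upTo⁺ (red-size e)) e)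
  ; supplied  = λ _ e a → true≢false e a }
  where open Valid val

-- Bound on the points computed by a stretch of moves with K vertices supplied from outside.
capacity : ℕ → ℕ → ℕ → ℕ
capacity M w K = 2 * K * w + K ^ 2 * M

-- Pays for a game that ends within its first stretch, which starts without red pebbles.
capacity-first : ∀ M w S n → n ≤ S → capacity M w n + 0 ≤ 4 * (w + S * M) * n
capacity-first M w S n n≤S with m≤n⇒∃[o]m+o≡n n≤S
-- With `S = n + d` the difference of the two sides is a polynomial with natural coefficients, the
-- last summand in `slack`.
... | d , refl = subst (capacity M w n + 0 ≤_) (sym (slack M w n d)) (m≤m+n _ _)
  where
  slack : ∀ M w n d → 4 * (w + (n + d) * M) * n ≡
          2 * n * w + (n * (n * 1)) * M + 0 + (2 * n * w + (3 * n * n + 4 * n * d) * M)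
  slack = solve-∀

-- Pays for a game that ends `n` loads into a later stretch, with up to `S` vertices red at its
-- start. The extra `capacity M w S` is the credit carried into that stretch.
capacity-next : ∀ M w S n → n ≤ S → capacity M w (S + n) + capacity M w S ≤ 4 * (w + S * M) * (S + n)
capacity-next M w S n n≤S with m≤n⇒∃[o]m+o≡n n≤S
... | d , refl = subst (capacity M w (n + d + n) + capacity M w (n + d) ≤_) (sym (slack M w n d)) (m≤m+n _ _)
  where
  slack : ∀ M w n d → 4 * (w + (n + d) * M) * (n + d + n) ≡
          2 * (n + d + n) * w + (n + d + n) * ((n + d + n) * 1) * M
          + (2 * (n + d) * w + (n + d) * ((n + d) * 1) * M)
          + (2 * n * w + (2 * (n + d) * (n + d) + 2 * n * d + n * n) * M)
  slack = solve-∀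

-- A later stretch with all its `S` loads uses up exactly the payment of `S` loads.
capacity-full : ∀ M w S → capacity M w (S + S) ≡ 4 * (w + S * M) * S
capacity-full = eq
  where
  eq : ∀ M w S → 2 * (S + S) * w + (S + S) * ((S + S) * 1) * M ≡ 4 * (w + S * M) * S
  eq = solve-∀

-- Amortised count of the loads of a game

module _ {G : CDAG} {M N : ℕ} (N<M : N < M) (H : Hourglass G M N) (S : ℕ) (1≤S : 1 ≤ S) where
  open CDAG G
  open Hourglass H
  open Segments N<M H
  open Config

  private
    W² X : ℕ
    W² = (M ∸ N) ^ 2
    X  = W² + S * M
    cap : ℕ → ℕ
    cap = capacity M W²

  capacity-mono : ∀ {K L} → K ≤ L → cap K ≤ cap L
  capacity-mono K≤L = +-mono-≤ (*-monoˡ-≤ W² (*-monoʳ-≤ 2 K≤L)) (*-monoˡ-≤ M (^-monoˡ-≤ 2 K≤L))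

  complete⇒pending-[] : ∀ {c} → Complete G c → length (pending (white c)) ≡ 0
  complete⇒pending-[] {c} complete =
    cong length (filter-none _ {xs = points M N} (All.tabulate λ p∈ e →
      true≢false (All.lookup complete (∈-upTo⁺ (V-size (∈-points {M} {N} p∈)))) e))

  close-segment : ∀ {c wa R} → Valid G c → Closed G wa → (∀ {v} → isInput v ≡ true → wa v ≡ true) → Window G wa R c →
    ∀ {K} → length R ≤ K → length (pending wa) * W² ≤ cap K + length (pending (white c)) * W²
  close-segment {c} {wa} {R} val closed inp win R≤K = ≤-trans
    (pending-bound {wa} {white c} {R} (record
      { wa-closed = closed ; wb-closed = Valid.white-closed val ; wa-input = inp ; supplied = Window.supplied win }))
    (+-monoˡ-≤ (length (pending (white c)) * W²) (capacity-mono R≤K))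

  -- The invariant weighs a stretch started with at most b red vertices; A is the
  -- credit kept back because the last stretch may stop before its S loads.
  pending-loads : ∀ {c ms wa R} → Game G S c ms → redCount G c ≤ S → Valid G c →
    Closed G wa → (∀ {v} → isInput v ≡ true → wa v ≡ true) → Window G wa R c →
    ∀ b A n → (∀ m → m ≤ S → cap (b + m) + A ≤ 4 * X * (b + m)) → cap (b + S) + A ≤ cap S + 4 * X * b →
    n ≤ S → length R ≤ b + n →
    length (pending wa) * W² + A ≤ 4 * X * (loads ms + (b + n))
  pending-loads {c} {wa = wa} (done complete) _ val closed inp win b A n c₁ c₂ n≤S R≤ = begin
    length (pending wa) * W² + A ≤⟨ +-monoˡ-≤ A (close-segment val closed inp win R≤) ⟩
    cap (b + n) + length (pending (white c)) * W² + A
      ≡⟨ cong (λ x → cap (b + n) + x * W² + A) (complete⇒pending-[] {c} complete) ⟩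
    cap (b + n) + 0 + A          ≡⟨ cong (_+ A) (+-identityʳ (cap (b + n))) ⟩
    cap (b + n) + A              ≤⟨ c₁ n n≤S ⟩
    4 * X * (b + n)              ∎
    where open ≤-Reasoning
  pending-loads (step {m = spill _} s r≤ g) _ val closed inp win b A n c₁ c₂ n≤S R≤ =
    pending-loads g r≤ (step-valid s val) closed inp (spill-window s win) b A n c₁ c₂ n≤S R≤
  pending-loads (step {m = compute _} s r≤ g) _ val closed inp win b A n c₁ c₂ n≤S R≤ =
    pending-loads g r≤ (step-valid s val) closed inp (compute-window s win) b A n c₁ c₂ n≤S R≤
  pending-loads {c} {wa = wa} {R} (step {m = load v} {ms = ms} s r≤ g) c≤ val closed inp win b A n c₁ c₂ n≤S R≤
    with m≤n⇒m<n∨m≡n n≤S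
  ... | inj₁ n<S = subst (λ x → length (pending wa) * W² + A ≤ 4 * X * x) (shift (loads ms) b n)
    (pending-loads g r≤ (step-valid s val) closed inp (load-window s win) b A (suc n) c₁ c₂ n<S
      (≤-trans (s≤s R≤) (≤-reflexive (sym (+-suc b n)))))
    where
    shift : ∀ q b n → q + (b + suc n) ≡ suc q + (b + n)
    shift = solve-∀
  -- The stretch already has its `S` loads. It is closed just before the current load, which becomes
  -- the first load of a new stretch; the second inequality exchanges the credit `A` for the credit
  -- `cap S` of that stretch.
  ... | inj₂ refl = begin
    length (pending wa) * W² + A      ≤⟨ +-monoˡ-≤ A (close-segment val closed inp win R≤) ⟩
    cap (b + S) + P * W² + A          ≡⟨ swap (cap (b + S)) (P * W²) A ⟩
    cap (b + S) + A + P * W²          ≤⟨ +-monoˡ-≤ (P * W²) c₂ ⟩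
    cap S + 4 * X * b + P * W²        ≡⟨ swap' (cap S) (4 * X * b) (P * W²) ⟩
    P * W² + cap S + 4 * X * b        ≤⟨ +-monoˡ-≤ (4 * X * b) next ⟩
    4 * X * (loads ms + (S + 1)) + 4 * X * b ≡⟨ collect X (loads ms) S b ⟩
    4 * X * (suc (loads ms) + (b + S)) ∎
    where
    open ≤-Reasoning
    P = length (pending (white c))
    swap : ∀ a b c → a + b + c ≡ a + c + b
    swap = solve-∀
    swap' : ∀ a b c → a + b + c ≡ c + a + b
    swap' = solve-∀
    collect : ∀ X q s b → 4 * X * (q + (s + 1)) + 4 * X * b ≡ 4 * X * (suc q + (b + s))
    collect = solve-∀
    next : P * W² + cap S ≤ 4 * X * (loads ms + (S + 1))
    next = pending-loads g r≤ (step-valid s val) (Valid.white-closed val) (Valid.input-white val)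
      (load-window s (new-window val)) S (cap S) 1 (capacity-next M W² S)
      (≤-reflexive (trans (cong (_+ cap S) (capacity-full M W² S)) (+-comm (4 * X * S) (cap S)))) 1≤S
      (≤-trans (s≤s (≤-trans (≤-reflexive (length-redList G c)) c≤)) (≤-reflexive (+-comm 1 S)))

  -- At the start the white set consists of the inputs. Updates are not inputs, so every point is
  -- pending; the first stretch has no red vertices and no credit.
  points-loads : ∀ {ms} → CompleteGame G S ms → length (points M N) * W² ≤ 4 * X * loads ms
  points-loads {ms} game = subst₂ _≤_ lhs (cong (4 * X *_) (+-identityʳ (loads ms)))
    (pending-loads game red₀ valid₀ closed₀ id window₀ 0 0 0 (capacity-first M W² S) (+-monoʳ-≤ (cap S) z≤n) z≤n z≤n)
    where
    closed₀ : Closed G isInput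
    closed₀ u∈ e with subst (_ ∈_) (input-preds e) u∈
    ... | ()
    valid₀ : Valid G (initConfig G)
    valid₀ = record { red-size = λ () ; red-white = λ () ; input-white = id ; white-closed = closed₀ }
    window₀ : Window G isInput [] (initConfig G)
    window₀ = record { wa-white = id ; available = λ () ; supplied = λ _ e a → true≢false e a }
    red₀ : redCount G (initConfig G) ≤ S
    red₀ = ≤-trans (≤-reflexive (trans (sym (length-redList G (initConfig G)))
      (cong length (filter-none _ {xs = upTo size} (All.tabulate λ _ ()))))) z≤n
    lhs : length (pending isInput) * W² + 0 ≡ length (points M N) * W²
    lhs = trans (+-identityʳ _) (cong (λ ps → length ps * W²)
      (filter-all _ {xs = points M N} (All.tabulate λ p∈ → V-isInput (∈-points {M} {N} p∈))))

-- The number of updates in closed form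

sum-upTo-suc : ∀ (f : ℕ → ℕ) n → sum (map f (upTo (suc n))) ≡ f 0 + sum (map (f ∘ suc) (upTo n))
sum-upTo-suc f n = cong (λ xs → f 0 + sum xs) (trans (map-applyUpTo suc f n) (sym (map-upTo (f ∘ suc) n)))

-- With `M = N + w` and `w` fixed, raising `N` by one shifts the summands by one place and adds a
-- new one at `k = 0`; this makes induction on `N` possible.
sum-formula : ∀ N w → 6 * sum (map (λ k → (N ∸ suc k) * (N + w ∸ suc k)) (upTo N)) ≡
                      N * (N ∸ 1) * (3 * (N + w) ∸ N ∸ 1)
sum-formula zero    w = refl
sum-formula (suc n) w = begin
  6 * sum (map f (upTo (suc n)))               ≡⟨ cong (6 *_) (sum-upTo-suc f n) ⟩
  6 * (n * (n + w) + sum (map g (upTo n)))     ≡⟨ *-distribˡ-+ 6 (n * (n + w)) _ ⟩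
  6 * (n * (n + w)) + 6 * sum (map g (upTo n)) ≡⟨ cong (6 * (n * (n + w)) +_) (sum-formula n w) ⟩
  6 * (n * (n + w)) + n * (n ∸ 1) * (3 * (n + w) ∸ n ∸ 1) ≡⟨ closed n ⟩
  suc n * n * (3 * (suc n + w) ∸ suc n ∸ 1)    ∎
  where
  open ≡-Reasoning
  f g : ℕ → ℕ
  f k = (suc n ∸ suc k) * (suc n + w ∸ suc k)
  g k = (n ∸ suc k) * (n + w ∸ suc k)
  -- The subtractions are exact, since three times `suc n + w` is at least `suc n + 1`.
  3M : ∀ n → 3 * (suc n + w) ∸ suc n ∸ 1 ≡ 2 * n + 3 * w + 1
  3M n = trans (∸-+-assoc (3 * (suc n + w)) (suc n) 1)
    (trans (cong (_∸ (suc n + 1)) (expand n w)) (m+n∸m≡n (suc n + 1) (2 * n + 3 * w + 1)))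
    where
    expand : ∀ n w → 3 * (suc n + w) ≡ suc n + 1 + (2 * n + 3 * w + 1)
    expand = solve-∀
  closed : ∀ n → 6 * (n * (n + w)) + n * (n ∸ 1) * (3 * (n + w) ∸ n ∸ 1) ≡
                 suc n * n * (3 * (suc n + w) ∸ suc n ∸ 1)
  -- For `n = 0` the last factor on the left may be truncated, but the factor `n` makes its product
  -- vanish.
  closed zero    = refl
  closed (suc m) = begin
    6 * (suc m * (suc m + w)) + suc m * m * (3 * (suc m + w) ∸ suc m ∸ 1)
      ≡⟨ cong (λ x → 6 * (suc m * (suc m + w)) + suc m * m * x) (3M m) ⟩
    6 * (suc m * (suc m + w)) + suc m * m * (2 * m + 3 * w + 1)           ≡⟨ poly m w ⟩
    suc (suc m) * suc m * (2 * suc m + 3 * w + 1)                         ≡⟨ cong (suc (suc m) * suc m *_) (sym (3M (suc m))) ⟩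
    suc (suc m) * suc m * (3 * (suc (suc m) + w) ∸ suc (suc m) ∸ 1)       ∎
    where
    poly : ∀ m w → 6 * (suc m * (suc m + w)) + suc m * m * (2 * m + 3 * w + 1) ≡
                   suc (suc m) * suc m * (2 * suc m + 3 * w + 1)
    poly = solve-∀

length-points : ∀ {M N} → N ≤ M → 6 * length (points M N) ≡ N * (N ∸ 1) * (3 * M ∸ N ∸ 1)
length-points {N = N} N≤M with m≤n⇒∃[o]m+o≡n N≤M
... | w , refl = trans (cong (6 *_) (trans (length-dependentProduct (upTo N) _)
    (cong sum (map-cong len (upTo N))))) (sum-formula N w)
  where
  len : ∀ k → length (cartesianProduct (range (suc k) N) (range (suc k) (N + w))) ≡ (N ∸ suc k) * (N + w ∸ suc k)
  len k = trans (length-cartesianProduct (range (suc k) N) _) (cong₂ _*_ (length-range (suc k) N) (length-range (suc k) (N + w)))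

hourglass-bound : ∀ {G M N S ms} → N < M → 1 ≤ S → Hourglass G M N → CompleteGame G S ms →
  N * (N ∸ 1) * (3 * M ∸ N ∸ 1) * (M ∸ N) ^ 2 ≤ 24 * ((M ∸ N) ^ 2 + S * M) * loads ms
hourglass-bound {G} {M} {N} {S} {ms} N<M 1≤S H game = begin
  N * (N ∸ 1) * (3 * M ∸ N ∸ 1) * W² ≡⟨ cong (_* W²) (sym (length-points (<⇒≤ N<M))) ⟩
  6 * length (points M N) * W²       ≡⟨ *-assoc 6 (length (points M N)) W² ⟩
  6 * (length (points M N) * W²)     ≤⟨ *-monoʳ-≤ 6 (points-loads N<M H S 1≤S game) ⟩
  6 * (4 * (W² + S * M) * loads ms)  ≡⟨ scale (W² + S * M) (loads ms) ⟩
  24 * (W² + S * M) * loads ms       ∎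
  where
  open ≤-Reasoning
  W² = (M ∸ N) ^ 2
  scale : ∀ x q → 6 * (4 * x * q) ≡ 24 * x * q
  scale = solve-∀

-- Straight-line programs with labelled vertices

open St

-- `iteration` is a tag that becomes part of the label of the created vertex.
record Instr : Set where
  constructor instr
  field
    iteration : ℕ
    reads     : List Cell
    target    : Cell
open Instr

exec : Instr → St → St
exec x = stmt (reads x) (target x)

run : List Instr → St → St
run xs s = foldl (λ s x → exec x s) s xs

sameCell-refl : ∀ c → sameCell c c ≡ true
sameCell-refl (cA i j) with i ≡ᵇ i | ≡⇒≡ᵇ i i refl | j ≡ᵇ j | ≡⇒≡ᵇ j j refl
... | true | _ | true | _ = refl
sameCell-refl (cT j) with j ≡ᵇ j | ≡⇒≡ᵇ j j refl
... | true | _ = refl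

sameCell-sound : ∀ c c' → sameCell c c' ≡ true → c ≡ c'
sameCell-sound (cA i j) (cA i' j') eq with i ≡ᵇ i' in p | j ≡ᵇ j' in q
... | true | true = cong₂ cA (≡ᵇ⇒≡ i i' (subst T (sym p) _)) (≡ᵇ⇒≡ j j' (subst T (sym q) _))
sameCell-sound (cT j) (cT j') eq = cong cT (≡ᵇ⇒≡ j j' (subst T (sym eq) _))

updCell-self : ∀ {X : Set} (f : Cell → X) c x → updCell f c x c ≡ x
updCell-self f c x rewrite sameCell-refl c = refl

updCell-other : ∀ {X : Set} (f : Cell → X) {c c'} x → c ≢ c' → updCell f c x c' ≡ f c'
updCell-other f {c} {c'} x c≢c' with sameCell c c' in eq
... | false = refl
... | true  = ⊥-elim (c≢c' (sameCell-sound c c' eq))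

updCell-just : ∀ (f : Cell → Maybe ℕ) {c c' n v} → updCell f c (just n) c' ≡ just v →
               (c ≡ c' × n ≡ v) ⊎ f c' ≡ just v
updCell-just f {c} {c'} eq with sameCell c c' in p
... | true  = inj₁ (sameCell-sound c c' p , just-injective eq)
... | false = inj₂ eq

Labelling : Set
Labelling = ℕ → ℕ × Cell

record Wf (s : St) (lab : Labelling) : Set where
  field
    writer-<     : ∀ {c v} → writer s c ≡ just v → v < next s
    inNode-<     : ∀ {c v} → inNode s c ≡ just v → v < next s
    inNode-lab   : ∀ {c v} → inNode s c ≡ just v → proj₂ (lab v) ≡ c
    inNode-input : ∀ {c v} → inNode s c ≡ just v → inputOf s v ≡ true
    input-preds  : ∀ {v} → inputOf s v ≡ true → predsOf s v ≡ []

-- Vertex numbers are handed out in increasing order and never reused, so edges and labels found at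
-- one moment persist in the final graph.
record Extends (s : St) (lab : Labelling) (s' : St) (lab' : Labelling) : Set where
  field
    next-≤       : next s ≤ next s'
    preds-same   : ∀ {v} → v < next s → predsOf s' v ≡ predsOf s v
    input-same   : ∀ {v} → v < next s → inputOf s' v ≡ inputOf s v
    lab-same     : ∀ {v} → v < next s → lab' v ≡ lab v
    inNode-mono  : ∀ {c v} → inNode s c ≡ just v → inNode s' c ≡ just v

Extends-refl : ∀ {s lab} → Extends s lab s lab
Extends-refl = record
  { next-≤ = ≤-refl ; preds-same = λ _ → refl ; input-same = λ _ → refl ; lab-same = λ _ → refl ; inNode-mono = id }

Extends-trans : ∀ {s₁ l₁ s₂ l₂ s₃ l₃} → Extends s₁ l₁ s₂ l₂ → Extends s₂ l₂ s₃ l₃ → Extends s₁ l₁ s₃ l₃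
Extends-trans a b = record
  { next-≤      = ≤-trans A.next-≤ B.next-≤
  ; preds-same  = λ v< → trans (B.preds-same (<-≤-trans v< A.next-≤)) (A.preds-same v<)
  ; input-same  = λ v< → trans (B.input-same (<-≤-trans v< A.next-≤)) (A.input-same v<)
  ; lab-same    = λ v< → trans (B.lab-same (<-≤-trans v< A.next-≤)) (A.lab-same v<)
  ; inNode-mono = B.inNode-mono ∘ A.inNode-mono }
  where
  module A = Extends a
  module B = Extends b

updℕ-below : ∀ {X : Set} (f : ℕ → X) {n v} x → v < n → updℕ f n x v ≡ f v
updℕ-below f x v<n = updℕ-other f x (<⇒≢ v<n)

record ReadSpec (c : Cell) (s : St) (lab : Labelling) (r : ℕ × St) : Set where
  field
    lab'        : Labelling
    wf          : Wf (proj₂ r) lab'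
    ext         : Extends s lab (proj₂ r) lab'
    writer-same : ∀ c' → writer (proj₂ r) c' ≡ writer s c'
    source      : writer s c ≡ just (proj₁ r) ⊎ (writer s c ≡ nothing × inNode (proj₂ r) c ≡ just (proj₁ r))

readCell-spec : ∀ c {s lab} → Wf s lab → ReadSpec c s lab (readCell c s)
readCell-spec c {s} {lab} wf with writer s c in eqw
... | just v = record { wf = wf ; ext = Extends-refl ; writer-same = λ _ → refl ; source = inj₁ eqw }
... | nothing with inNode s c in eqi
...   | just v = record { wf = wf ; ext = Extends-refl ; writer-same = λ _ → refl ; source = inj₂ (eqw , eqi) }
...   | nothing = record
  { lab' = updℕ lab n (0 , c)
  ; wf = record
    { writer-<     = λ e → m≤n⇒m≤1+n (writer-< e)
    ; inNode-<     = inNode-<′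
    ; inNode-lab   = inNode-lab′
    ; inNode-input = inNode-input′
    ; input-preds  = input-preds′ }
  ; ext = record
    { next-≤ = n≤1+n n
    ; preds-same  = updℕ-below (predsOf s) []
    ; input-same  = updℕ-below (inputOf s) true
    ; lab-same    = updℕ-below lab (0 , c)
    ; inNode-mono = λ {c'} e → trans (updCell-other (inNode s) {c} (just n) λ { refl → nothing≢just (trans (sym eqi) e) }) e }
  ; writer-same = λ _ → refl
  ; source = inj₂ (eqw , updCell-self (inNode s) c (just n)) }
  where
  open Wf wf
  n = next s
  nothing≢just : ∀ {v : ℕ} → nothing ≢ just v
  nothing≢just ()
  inNode-<′ : ∀ {c' v} → updCell (inNode s) c (just n) c' ≡ just v → v < suc n
  inNode-<′ e with updCell-just (inNode s) {c} e
  ... | inj₁ (_ , refl) = ≤-refl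
  ... | inj₂ e'         = m≤n⇒m≤1+n (inNode-< e')
  inNode-lab′ : ∀ {c' v} → updCell (inNode s) c (just n) c' ≡ just v → proj₂ (updℕ lab n (0 , c) v) ≡ c'
  inNode-lab′ e with updCell-just (inNode s) {c} e
  ... | inj₁ (refl , refl) = cong proj₂ (updℕ-self lab n (0 , c))
  ... | inj₂ e'            = trans (cong proj₂ (updℕ-below lab (0 , c) (inNode-< e'))) (inNode-lab e')
  inNode-input′ : ∀ {c' v} → updCell (inNode s) c (just n) c' ≡ just v → updℕ (inputOf s) n true v ≡ true
  inNode-input′ e with updCell-just (inNode s) {c} e
  ... | inj₁ (refl , refl) = updℕ-self (inputOf s) n true
  ... | inj₂ e'            = updℕ-true⁺ (inputOf s) n (inNode-input e')
  input-preds′ : ∀ {v} → updℕ (inputOf s) n true v ≡ true → updℕ (predsOf s) n [] v ≡ []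
  input-preds′ {v} e with v ≟ n
  ... | yes refl = updℕ-self (predsOf s) n []
  ... | no  v≢n  = trans (updℕ-other (predsOf s) [] v≢n) (input-preds (trans (sym (updℕ-other (inputOf s) true v≢n)) e))

record ReadsSpec (cs : List Cell) (s : St) (lab : Labelling) (r : List ℕ × St) : Set where
  field
    lab'        : Labelling
    wf          : Wf (proj₂ r) lab'
    ext         : Extends s lab (proj₂ r) lab'
    writer-same : ∀ c → writer (proj₂ r) c ≡ writer s c
    source-written : ∀ {c u} → c ∈ cs → writer s c ≡ just u → u ∈ proj₁ r
    source-input   : ∀ {c} → c ∈ cs → writer s c ≡ nothing → ∃[ u ] inNode (proj₂ r) c ≡ just u × u ∈ proj₁ r

readCells-spec : ∀ cs {s lab} → Wf s lab → ReadsSpec cs s lab (readCells cs s)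
readCells-spec [] wf = record
  { wf = wf ; ext = Extends-refl ; writer-same = λ _ → refl ; source-written = λ () ; source-input = λ () }
readCells-spec (c ∷ cs) {s} wf with readCell c s | readCell-spec c wf
... | v , s₁ | one with readCells cs s₁ | readCells-spec cs (ReadSpec.wf one)
...   | vs , s₂ | rest = record
  { wf = B.wf
  ; ext = Extends-trans A.ext B.ext
  ; writer-same = λ c' → trans (B.writer-same c') (A.writer-same c')
  ; source-written = written
  ; source-input = input }
  where
  module A = ReadSpec one
  module B = ReadsSpec rest
  written : ∀ {c' u} → c' ∈ c ∷ cs → writer s c' ≡ just u → u ∈ v ∷ vs
  written (there c∈) e = there (B.source-written c∈ (trans (A.writer-same _) e))
  written (here refl) e with A.source
  ... | inj₁ e'       = here (just-injective (trans (sym e) e'))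
  ... | inj₂ (e' , _) with trans (sym e) e'
  ...   | ()
  input : ∀ {c'} → c' ∈ c ∷ cs → writer s c' ≡ nothing → ∃[ u ] inNode s₂ c' ≡ just u × u ∈ v ∷ vs
  input (there c∈) e with B.source-input c∈ (trans (A.writer-same _) e)
  ... | u , eq , u∈ = u , eq , there u∈
  input (here refl) e with A.source
  ... | inj₂ (_ , eq) = v , Extends.inNode-mono B.ext eq , here refl
  ... | inj₁ e' with trans (sym e) e'
  ...   | ()

record Labelled : Set where
  constructor labelled
  field
    state : St
    lab   : Labelling
    wf    : Wf state lab
open Labelled using (state; lab)

_⊑_ : Labelled → Labelled → Set
g ⊑ g' = Extends (state g) (lab g) (state g') (lab g')

writerOf : Labelled → Cell → Maybe ℕ
writerOf g = writer (state g)

vertexOf : Instr → Labelled → ℕ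
vertexOf x g = next (proj₂ (readCells (reads x) (state g)))

module _ (x : Instr) (g : Labelled) where
  private
    n = vertexOf x g
    ps = proj₁ (readCells (reads x) (state g))
    s' = proj₂ (readCells (reads x) (state g))
    module R = ReadsSpec (readCells-spec (reads x) (Labelled.wf g))
    module W = Wf R.wf

  -- Outside this block an executed instruction is known only through the facts listed here, so
  -- states do not unfold.
  opaque
    gexec : Labelled
    gexec = labelled (exec x (state g)) (updℕ R.lab' n (iteration x , target x)) record
      { writer-<     = writer-<′
      ; inNode-<     = λ e → m≤n⇒m≤1+n (W.inNode-< e)
      ; inNode-lab   = λ e → trans (cong proj₂ (updℕ-below R.lab' (iteration x , target x) (W.inNode-< e))) (W.inNode-lab e)
      ; inNode-input = λ e → trans (updℕ-below (inputOf s') false (W.inNode-< e)) (W.inNode-input e)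
      ; input-preds  = input-preds′ }
      where
      writer-<′ : ∀ {c v} → updCell (writer s') (target x) (just n) c ≡ just v → v < suc n
      writer-<′ e with updCell-just (writer s') {target x} e
      ... | inj₁ (_ , refl) = ≤-refl
      ... | inj₂ e'         = m≤n⇒m≤1+n (W.writer-< e')
      input-preds′ : ∀ {v} → updℕ (inputOf s') n false v ≡ true → updℕ (predsOf s') n ps v ≡ []
      input-preds′ {v} e with v ≟ n
      ... | yes refl = true≢false e (updℕ-self (inputOf s') n false)
      ... | no  v≢n  = trans (updℕ-other (predsOf s') ps v≢n)
                         (W.input-preds (trans (sym (updℕ-other (inputOf s') false v≢n)) e))

    state-gexec : state gexec ≡ exec x (state g)
    state-gexec = refl

    gexec-⊑ : g ⊑ gexec
    gexec-⊑ = Extends-trans R.ext record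
      { next-≤ = n≤1+n n
      ; preds-same  = updℕ-below (predsOf s') ps
      ; input-same  = updℕ-below (inputOf s') false
      ; lab-same    = updℕ-below R.lab' (iteration x , target x)
      ; inNode-mono = id }

    writer-target : writerOf gexec (target x) ≡ just n
    writer-target = updCell-self (writer s') (target x) (just n)

    writer-other : ∀ {c} → target x ≢ c → writerOf gexec c ≡ writerOf g c
    writer-other t≢c = trans (updCell-other (writer s') (just n) t≢c) (R.writer-same _)

    lab-exec : lab gexec n ≡ (iteration x , target x)
    lab-exec = updℕ-self R.lab' n (iteration x , target x)

    vertex-< : ∀ f → gexec ⊑ f → n < next (state f)
    vertex-< f = Extends.next-≤

    vertex-input : ∀ f → gexec ⊑ f → inputOf (state f) n ≡ false
    vertex-input f ext = trans (Extends.input-same ext ≤-refl) (updℕ-self (inputOf s') n false)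

    vertex-preds : ∀ f → gexec ⊑ f → predsOf (state f) n ≡ ps
    vertex-preds f ext = trans (Extends.preds-same ext ≤-refl) (updℕ-self (predsOf s') n ps)

    pred-written : ∀ f → gexec ⊑ f → ∀ {c u} → c ∈ reads x → writerOf g c ≡ just u → u ∈ predsOf (state f) n
    pred-written f ext {u = u} c∈ e = subst (u ∈_) (sym (vertex-preds f ext)) (R.source-written c∈ e)

    pred-input : ∀ f → gexec ⊑ f → ∀ {c} → c ∈ reads x → writerOf g c ≡ nothing →
                 ∃[ u ] inNode (state f) c ≡ just u × u ∈ predsOf (state f) n
    pred-input f ext c∈ e with R.source-input c∈ e
    ... | u , eq , u∈ = u , Extends.inNode-mono ext eq , subst (u ∈_) (sym (vertex-preds f ext)) u∈

grun : List Instr → Labelled → Labelled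
grun []       g = g
grun (x ∷ xs) g = grun xs (gexec x g)

state-grun : ∀ xs g → state (grun xs g) ≡ run xs (state g)
state-grun []       g = refl
state-grun (x ∷ xs) g = trans (state-grun xs (gexec x g)) (cong (run xs) (state-gexec x g))

grun-++ : ∀ xs ys g → grun (xs ++ ys) g ≡ grun ys (grun xs g)
grun-++ []       ys g = refl
grun-++ (x ∷ xs) ys g = grun-++ xs ys (gexec x g)

grun-⊑ : ∀ xs g → g ⊑ grun xs g
grun-⊑ []       g = Extends-refl
grun-⊑ (x ∷ xs) g = Extends-trans (gexec-⊑ x g) (grun-⊑ xs (gexec x g))

NoWrite : Cell → List Instr → Set
NoWrite c xs = ∀ {x} → x ∈ xs → target x ≢ c

writer-grun : ∀ {c} xs g → NoWrite c xs → writerOf (grun xs g) c ≡ writerOf g c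
writer-grun []       g nw = refl
writer-grun (x ∷ xs) g nw = trans (writer-grun xs (gexec x g) (nw ∘ there)) (writer-other x g (nw (here refl)))

Current : ℕ → Cell → Labelled → Set
Current k c g = ∃[ v ] writerOf g c ≡ just v × lab g v ≡ (k , c)

_≟ᶜ_ : (c c' : Cell) → Dec (c ≡ c')
c ≟ᶜ c' with sameCell c c' in eq
... | true  = yes (sameCell-sound c c' eq)
... | false = no λ { refl → true≢false (sameCell-refl c) eq }

current-exec : ∀ x g {k} → iteration x ≡ k → Current k (target x) (gexec x g)
current-exec x g refl = vertexOf x g , writer-target x g , lab-exec x g

-- A later write to `c` in the same iteration creates a vertex with the same label, whichever
-- instruction it comes from.
current-grun : ∀ {k c} xs g → (∀ {x} → x ∈ xs → iteration x ≡ k) → Current k c g → Current k c (grun xs g)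
current-grun []       g tags cur = cur
current-grun {c = c} (x ∷ xs) g tags cur@(v , eq , eql) = current-grun xs (gexec x g) (tags ∘ there) next-cur
  where
  next-cur : Current _ c (gexec x g)
  next-cur with target x ≟ᶜ c
  ... | yes refl = current-exec x g (tags (here refl))
  ... | no  t≢c  = v , trans (writer-other x g t≢c) eq
                     , trans (Extends.lab-same (gexec-⊑ x g) (Wf.writer-< (Labelled.wf g) eq)) eql

current-∈ : ∀ {k x} xs g → (∀ {x} → x ∈ xs → iteration x ≡ k) → x ∈ xs → Current k (target x) (grun xs g)
current-∈ (x ∷ xs) g tags (here refl) = current-grun xs (gexec x g) (tags ∘ there) (current-exec x g (tags (here refl)))
current-∈ (x ∷ xs) g tags (there x∈)  = current-∈ xs (gexec x g) (tags ∘ there) x∈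

-- Meant for an instruction that alone in its block writes its target: it names the state in which
-- the instruction runs and identifies the writer found after the block.
record Visit (x : Instr) (xs : List Instr) (g : Labelled) : Set where
  field
    before : Labelled
    target-before : writerOf before (target x) ≡ writerOf g (target x)
    other-before  : ∀ {c} → NoWrite c xs → writerOf before c ≡ writerOf g c
    target-after  : writerOf (grun xs g) (target x) ≡ just (vertexOf x before)
    after-⊑       : gexec x before ⊑ grun xs g

visit : ∀ {x xs} g → Unique xs → x ∈ xs → (∀ {y} → y ∈ xs → target y ≡ target x → y ≡ x) → Visit x xs g
visit {x} {.x ∷ xs} g (x∉ ∷ _) (here refl) inj = record
  { before = g
  ; target-before = refl
  ; other-before = λ _ → refl
  ; target-after = trans (writer-grun xs (gexec x g) λ y∈ eq → All.lookup x∉ y∈ (sym (inj (there y∈) eq))) (writer-target x g)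
  ; after-⊑ = grun-⊑ xs (gexec x g) }
visit {x} {y ∷ xs} g (y∉ ∷ u) (there x∈) inj with visit (gexec y g) u x∈ (inj ∘ there)
... | vis = record
  { before = before
  ; target-before = trans target-before (writer-other y g λ eq → All.lookup y∉ x∈ (inj (here refl) eq))
  ; other-before = λ nw → trans (other-before (nw ∘ there)) (writer-other y g (nw (here refl)))
  ; target-after = target-after
  ; after-⊑ = after-⊑ }
  where open Visit vis

forEach≡run : ∀ {f : ℕ → St → St} {l : ℕ → List Instr} → (∀ x s → f x s ≡ run (l x) s) →
              ∀ xs s → forEach xs f s ≡ run (concatMap l xs) s
forEach≡run fl []       s = refl
forEach≡run {f} {l} fl (x ∷ xs) s = begin
  forEach xs f (f x s)                    ≡⟨ forEach≡run fl xs (f x s) ⟩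
  run (concatMap l xs) (f x s)            ≡⟨ cong (run (concatMap l xs)) (fl x s) ⟩
  run (concatMap l xs) (run (l x) s)      ≡⟨ sym (foldl-++ (λ s x → exec x s) s (l x) (concatMap l xs)) ⟩
  run (l x ++ concatMap l xs) s           ∎
  where open ≡-Reasoning

forEach-map≡run : ∀ (l : ℕ → Instr) xs s → forEach xs (exec ∘ l) s ≡ run (map l xs) s
forEach-map≡run l []       s = refl
forEach-map≡run l (x ∷ xs) s = forEach-map≡run l xs (exec (l x) s)

-- One iteration of the outer loop

∈-concatMap-find : {A B : Set} (f : A → List B) (xs : List A) {y : B} → y ∈ concatMap f xs → ∃[ x ] x ∈ xs × y ∈ f x
∈-concatMap-find f xs y∈ = find (∈-concatMap⁻ f {xs = xs} y∈)

concatMap≡cartesianProductWith : {A B C : Set} (f : A → B → C) (xs : List A) (ys : List B) →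
                                 concatMap (λ x → map (f x) ys) xs ≡ cartesianProductWith f xs ys
concatMap≡cartesianProductWith f []       ys = refl
concatMap≡cartesianProductWith f (x ∷ xs) ys = cong (map (f x) ys ++_) (concatMap≡cartesianProductWith f xs ys)

module Program (M N k : ℕ) where

  rows cols : List ℕ
  rows = range (suc k) M
  cols = range (suc k) N

  zeroI scaleI topI : ℕ → Instr
  zeroI j  = instr k [] (cT j)
  scaleI j = instr k (cT j ∷ cT k ∷ []) (cT j)
  topI j   = instr k (cT j ∷ []) (cA k j)

  accI updI : ℕ → ℕ → Instr
  accI j i = instr k (cT j ∷ cA i k ∷ cA i j ∷ []) (cT j)
  updI j i = instr k (cA i j ∷ cA i k ∷ cT j ∷ []) (cA i j)

  diagI : Instr
  diagI = instr k (cT k ∷ []) (cA k k)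

  leftI : ℕ → Instr
  leftI i = instr k (cA i k ∷ cT k ∷ []) (cA i k)

  reduceL : ℕ → List Instr
  reduceL j = zeroI j ∷ map (accI j) rows

  -- The blocks in program order; the diagonal and the top row share `L₃`. As a product, `L₄`
  -- inherits distinctness from the two ranges.
  L₁ L₂ L₃ L₄ L₅ : List Instr
  L₁ = concatMap reduceL cols
  L₂ = map scaleI cols
  L₃ = diagI ∷ map topI cols
  L₄ = cartesianProductWith updI cols rows
  L₅ = map leftI rows

  body≡run : ∀ s → body M N k s ≡ run L₅ (run L₄ (run L₃ (run L₂ (run L₁ s))))
  body≡run s =
    trans (forEach-map≡run leftI rows _) (cong (run L₅)
    (trans (update _) (cong (run L₄)
    (trans (forEach-map≡run topI cols _) (cong (run L₃)
    (trans (forEach-map≡run scaleI cols _) (cong (run L₂)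
    (reduce s))))))))
    where
    reduce : ∀ s → _ ≡ run L₁ s
    reduce = forEach≡run {l = reduceL} (λ j s → forEach-map≡run (accI j) rows (exec (zeroI j) s)) cols
    update : ∀ s → _ ≡ run L₄ s
    update s = trans (forEach≡run {l = λ j → map (updI j) rows} (λ j → forEach-map≡run (updI j) rows) cols s)
                     (cong (λ xs → run xs s) (concatMap≡cartesianProductWith updI cols rows))

  reduceL-target : ∀ js {x} → x ∈ concatMap reduceL js → ∃[ j ] j ∈ js × target x ≡ cT j
  reduceL-target js x∈ with ∈-concatMap-find reduceL js x∈
  ... | j , j∈ , here refl = j , j∈ , refl
  ... | j , j∈ , there x∈′ with ∈-map⁻ (accI j) x∈′
  ...   | _ , _ , refl = j , j∈ , refl

  L₂-target : ∀ {x} → x ∈ L₂ → ∃[ j ] x ≡ scaleI j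
  L₂-target x∈ with ∈-map⁻ scaleI x∈
  ... | j , _ , eq = j , eq

  L₃-target : ∀ {x} → x ∈ L₃ → ∃[ j ] k ≤ j × target x ≡ cA k j × iteration x ≡ k
  L₃-target (here refl) = k , ≤-refl , refl , refl
  L₃-target (there x∈) with ∈-map⁻ topI x∈
  ... | j , j∈ , refl = j , <⇒≤ (proj₁ (∈-range⁻ {b = N} j∈)) , refl , refl

  L₄-target : ∀ {x} → x ∈ L₄ → ∃[ i ] ∃[ j ] k < j × x ≡ updI j i
  L₄-target x∈ with ∈-cartesianProductWith⁻ updI cols rows x∈
  ... | j , i , j∈ , _ , refl = i , j , proj₁ (∈-range⁻ {b = N} j∈) , refl

  L₅-target : ∀ {x} → x ∈ L₅ → ∃[ i ] x ≡ leftI i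
  L₅-target x∈ with ∈-map⁻ leftI x∈
  ... | i , _ , eq = i , eq

  L₁-noA : ∀ {i j} → NoWrite (cA i j) L₁
  L₁-noA x∈ eq with reduceL-target cols x∈
  ... | _ , _ , eq′ with trans (sym eq) eq′
  ...   | ()

  L₂-noA : ∀ {i j} → NoWrite (cA i j) L₂
  L₂-noA x∈ eq with L₂-target x∈
  L₂-noA x∈ () | _ , refl

  L₃-noT : ∀ {j} → NoWrite (cT j) L₃
  L₃-noT x∈ eq with L₃-target x∈
  ... | _ , _ , eq′ , _ with trans (sym eq) eq′
  ...   | ()

  L₃-noA : ∀ {i j} → k ≢ i ⊎ j < k → NoWrite (cA i j) L₃
  L₃-noA other x∈ eq with L₃-target x∈
  ... | _ , k≤j , eq′ , _ with trans (sym eq) eq′ | other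
  ...   | refl | inj₁ k≢i = k≢i refl
  ...   | refl | inj₂ j<k = <⇒≱ j<k k≤j

  L₄-noT : ∀ {j} → NoWrite (cT j) L₄
  L₄-noT x∈ eq with L₄-target x∈
  L₄-noT x∈ () | _ , _ , _ , refl

  L₄-noA : ∀ {i j} → j ≤ k → NoWrite (cA i j) L₄
  L₄-noA j≤k x∈ eq with L₄-target x∈
  L₄-noA j≤k x∈ refl | _ , _ , k<j , refl = <⇒≱ k<j j≤k

  L₅-noA : ∀ {i j} → k ≢ j → NoWrite (cA i j) L₅
  L₅-noA k≢j x∈ eq with L₅-target x∈
  L₅-noA k≢j x∈ refl | _ , refl = k≢j refl

  iter₃ : ∀ {x} → x ∈ L₃ → iteration x ≡ k
  iter₃ x∈ with L₃-target x∈
  ... | _ , _ , _ , eq = eq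

  iter₄ : ∀ {x} → x ∈ L₄ → iteration x ≡ k
  iter₄ x∈ with L₄-target x∈
  ... | _ , _ , _ , refl = refl

  iter₅ : ∀ {x} → x ∈ L₅ → iteration x ≡ k
  iter₅ x∈ with L₅-target x∈
  ... | _ , refl = refl

  module After (g : Labelled) where

    g₁ g₂ g₃ g₄ g₅ : Labelled
    g₁ = grun L₁ g
    g₂ = grun L₂ g₁
    g₃ = grun L₃ g₂
    g₄ = grun L₄ g₃
    g₅ = grun L₅ g₄

    g₂⊑ : g₂ ⊑ g₅
    g₂⊑ = Extends-trans (grun-⊑ L₃ g₂) (Extends-trans (grun-⊑ L₄ g₃) (grun-⊑ L₅ g₄))

    g₁⊑ : g₁ ⊑ g₅
    g₁⊑ = Extends-trans (grun-⊑ L₂ g₁) g₂⊑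

    g⊑ : g ⊑ g₅
    g⊑ = Extends-trans (grun-⊑ L₁ g) g₁⊑

    state-after : state g₅ ≡ body M N k (state g)
    state-after = sym (trans (body≡run (state g)) (sym
      (trans (state-grun L₅ g₄) (cong (run L₅)
      (trans (state-grun L₄ g₃) (cong (run L₄)
      (trans (state-grun L₃ g₂) (cong (run L₃)
      (trans (state-grun L₂ g₁) (cong (run L₂)
      (state-grun L₁ g)))))))))))

    g₂-A : ∀ {i j} → writerOf g₂ (cA i j) ≡ writerOf g (cA i j)
    g₂-A = trans (writer-grun L₂ g₁ L₂-noA) (writer-grun L₁ g L₁-noA)

    g₃-A : ∀ {i j} → k ≢ i ⊎ j < k → writerOf g₃ (cA i j) ≡ writerOf g (cA i j)
    g₃-A other = trans (writer-grun L₃ g₂ (L₃-noA other)) g₂-A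

    unwritten : ∀ {i j} → j < k → writerOf g₅ (cA i j) ≡ writerOf g (cA i j)
    unwritten j<k = trans (writer-grun L₅ g₄ (L₅-noA λ k≡j → <⇒≢ j<k (sym k≡j)))
      (trans (writer-grun L₄ g₃ (L₄-noA (<⇒≤ j<k))) (g₃-A (inj₂ j<k)))

    current-after : ∀ {i j} → k ≤ i → i < M → k ≤ j → j < N → Current k (cA i j) g₅
    current-after {i} {j} k≤i i<M k≤j j<N with m≤n⇒m<n∨m≡n k≤i | m≤n⇒m<n∨m≡n k≤j
    ... | inj₁ k<i  | inj₁ k<j  = current-grun L₅ g₄ iter₅
      (current-∈ L₄ g₃ iter₄ (∈-cartesianProductWith⁺ updI (∈-range⁺ k<j j<N) (∈-range⁺ k<i i<M)))
    ... | inj₁ k<i  | inj₂ refl = current-∈ L₅ g₄ iter₅ (∈-map⁺ leftI (∈-range⁺ k<i i<M))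
    ... | inj₂ refl | inj₂ refl = current-grun L₅ g₄ iter₅ (current-grun L₄ g₃ iter₄ (current-∈ L₃ g₂ iter₃ (here refl)))
    ... | inj₂ refl | inj₁ k<j  = current-grun L₅ g₄ iter₅ (current-grun L₄ g₃ iter₄
      (current-∈ L₃ g₂ iter₃ (there (∈-map⁺ topI (∈-range⁺ k<j j<N)))))

    -- `L₁` writes tau[j] many times, so the state just before the accumulation at row `i` is given
    -- by an explicit prefix instead of a `Visit`.
    rowState : ℕ → ℕ → Labelled
    rowState j i = grun (zeroI j ∷ map (accI j) (range (suc k) i)) (grun (concatMap reduceL (range (suc k) j)) g)

    srOf : ℕ → ℕ → ℕ
    srOf i j = vertexOf (accI j i) (rowState j i)

    -- For `k < j < N` the default `0` does not occur, by `stOf-writer`.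
    stOf : ℕ → ℕ
    stOf j = fromMaybe 0 (writerOf g₂ (cT j))

    rowState-suc : ∀ {j i} → k < i → rowState j (suc i) ≡ gexec (accI j i) (rowState j i)
    rowState-suc {j} {i} k<i = trans
      (cong (λ xs → grun (zeroI j ∷ xs) h) (trans (cong (map (accI j)) (range-snoc k<i)) (map-++ (accI j) (range (suc k) i) _)))
      (grun-++ (zeroI j ∷ map (accI j) (range (suc k) i)) (accI j i ∷ []) h)
      where
      h = grun (concatMap reduceL (range (suc k) j)) g

    rowState-A : ∀ {j i i' j'} → writerOf (rowState j i) (cA i' j') ≡ writerOf g (cA i' j')
    rowState-A {j} {i} = trans (writer-grun (zeroI j ∷ map (accI j) (range (suc k) i)) _ nw)
                               (writer-grun (concatMap reduceL (range (suc k) j)) g nw′)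
      where
      nw : ∀ {i' j'} → NoWrite (cA i' j') (zeroI j ∷ map (accI j) (range (suc k) i))
      nw (here refl) ()
      nw (there x∈) eq with ∈-map⁻ (accI j) x∈
      nw (there x∈) () | _ , _ , refl
      nw′ : ∀ {i' j'} → NoWrite (cA i' j') (concatMap reduceL (range (suc k) j))
      nw′ x∈ eq with reduceL-target (range (suc k) j) x∈
      ... | _ , _ , eq′ with trans (sym eq) eq′
      ...   | ()

    g₁-split : ∀ {j} → k < j → j < N → g₁ ≡ grun (concatMap reduceL (range (suc j) N)) (rowState j M)
    g₁-split {j} k<j j<N = begin
      grun (concatMap reduceL cols) g
        ≡⟨ cong (λ xs → grun (concatMap reduceL xs) g) (range-split k<j j<N) ⟩
      grun (concatMap reduceL (is₁ ++ j ∷ is₂)) g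
        ≡⟨ cong (λ xs → grun xs g) (concatMap-++ reduceL is₁ (j ∷ is₂)) ⟩
      grun (concatMap reduceL is₁ ++ reduceL j ++ concatMap reduceL is₂) g
        ≡⟨ grun-++ (concatMap reduceL is₁) _ g ⟩
      grun (reduceL j ++ concatMap reduceL is₂) (grun (concatMap reduceL is₁) g)
        ≡⟨ grun-++ (reduceL j) (concatMap reduceL is₂) _ ⟩
      grun (concatMap reduceL is₂) (rowState j M) ∎
      where
      open ≡-Reasoning
      is₁ = range (suc k) j
      is₂ = range (suc j) N

    sr-⊑ : ∀ {i j} → InRange M N k i j → gexec (accI j i) (rowState j i) ⊑ g₅
    sr-⊑ {i} {j} (inRange k<i i<M k<j j<N) = Extends-trans
      (subst (gexec (accI j i) (rowState j i) ⊑_) (sym rest) (grun-⊑ (map (accI j) is₂) _))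
      (Extends-trans (subst (rowState j M ⊑_) (sym (g₁-split k<j j<N))
        (grun-⊑ (concatMap reduceL (range (suc j) N)) (rowState j M))) g₁⊑)
      where
      is₁ = range (suc k) i
      is₂ = range (suc i) M
      h = grun (concatMap reduceL (range (suc k) j)) g
      rest : rowState j M ≡ grun (map (accI j) is₂) (gexec (accI j i) (rowState j i))
      rest = trans
        (cong (λ xs → grun (zeroI j ∷ xs) h) (trans (cong (map (accI j)) (range-split k<i i<M)) (map-++ (accI j) is₁ _)))
        (grun-++ (zeroI j ∷ map (accI j) is₁) (accI j i ∷ map (accI j) is₂) h)

    sr-after : ∀ {i j} → InRange M N k i j → suc i ≡ M → writerOf g₁ (cT j) ≡ just (srOf i j)
    sr-after {i} {j} (inRange k<i _ k<j j<N) refl = begin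
      writerOf g₁ (cT j)                     ≡⟨ cong (λ h → writerOf h (cT j)) (g₁-split k<j j<N) ⟩
      writerOf (grun (concatMap reduceL (range (suc j) N)) (rowState j (suc i))) (cT j)
                                             ≡⟨ writer-grun _ (rowState j (suc i)) nw ⟩
      writerOf (rowState j (suc i)) (cT j)   ≡⟨ cong (λ h → writerOf h (cT j)) (rowState-suc k<i) ⟩
      writerOf (gexec (accI j i) (rowState j i)) (cT j) ≡⟨ writer-target (accI j i) (rowState j i) ⟩
      just (srOf i j) ∎
      where
      open ≡-Reasoning
      nw : NoWrite (cT j) (concatMap reduceL (range (suc j) N))
      nw x∈ eq with reduceL-target (range (suc j) N) x∈
      ... | j' , j'∈ , eq′ with trans (sym eq) eq′
      ...   | refl = <-irrefl refl (proj₁ (∈-range⁻ {b = N} j'∈))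

    scale-visit : ∀ {j} → k < j → j < N → Visit (scaleI j) L₂ g₁
    scale-visit {j} k<j j<N = visit g₁ (Unique.map⁺ (λ { refl → refl }) (Unique-range (suc k) N))
      (∈-map⁺ scaleI (∈-range⁺ k<j j<N)) inj
      where
      inj : ∀ {y} → y ∈ L₂ → target y ≡ cT j → y ≡ scaleI j
      inj y∈ eq with L₂-target y∈
      inj y∈ refl | _ , refl = refl

    update-visit : ∀ {i j} → InRange M N k i j → Visit (updI j i) L₄ g₃
    update-visit {i} {j} (inRange k<i i<M k<j j<N) = visit g₃
      (Unique.cartesianProductWith⁺ updI (λ { refl → refl , refl }) (Unique-range (suc k) N) (Unique-range (suc k) M))
      (∈-cartesianProductWith⁺ updI (∈-range⁺ k<j j<N) (∈-range⁺ k<i i<M)) inj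
      where
      inj : ∀ {y} → y ∈ L₄ → target y ≡ cA i j → y ≡ updI j i
      inj y∈ eq with L₄-target y∈
      inj y∈ refl | _ , _ , _ , refl = refl

    left-visit : ∀ {i} → k < i → i < M → Visit (leftI i) L₅ g₄
    left-visit {i} k<i i<M = visit g₄ (Unique.map⁺ (λ { refl → refl }) (Unique-range (suc k) M))
      (∈-map⁺ leftI (∈-range⁺ k<i i<M)) inj
      where
      inj : ∀ {y} → y ∈ L₅ → target y ≡ cA i k → y ≡ leftI i
      inj y∈ eq with L₅-target y∈
      inj y∈ refl | _ , refl = refl

    stOf-writer : ∀ {j} (k<j : k < j) (j<N : j < N) →
                  writerOf g₂ (cT j) ≡ just (stOf j) × stOf j ≡ vertexOf (scaleI j) (Visit.before (scale-visit k<j j<N))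
    stOf-writer k<j j<N with Visit.target-after (scale-visit k<j j<N)
    ... | eq = trans eq (cong just (sym (cong (fromMaybe 0) eq))) , cong (fromMaybe 0) eq

    module Edges {f : Labelled} (ext : g₅ ⊑ f) where

      predsF : ℕ → List ℕ
      predsF = predsOf (state f)
        where open St

      st-edge : ∀ {i j} → InRange M N k i j → suc i ≡ M → srOf i j ∈ predsF (stOf j)
      st-edge {i} {j} r@(inRange _ _ k<j j<N) i-last = subst (λ v → srOf i j ∈ predsF v) (sym (proj₂ (stOf-writer k<j j<N)))
        (pred-written (scaleI j) before f (Extends-trans after-⊑ (Extends-trans g₂⊑ ext)) (here refl)
          (trans target-before (sr-after r i-last)))
        where open Visit (scale-visit k<j j<N)

      private
        sr-ext : ∀ {i j} → InRange M N k i j → gexec (accI j i) (rowState j i) ⊑ f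
        sr-ext r = Extends-trans (sr-⊑ r) ext

      sr-edge : ∀ {i j} → InRange M N k i j → suc i < M → srOf i j ∈ predsF (srOf (suc i) j)
      sr-edge {i} {j} r@(inRange k<i _ k<j j<N) si<M =
        pred-written (accI j (suc i)) (rowState j (suc i)) f (sr-ext (inRange (m<n⇒m<1+n k<i) si<M k<j j<N)) (here refl)
          (trans (cong (λ h → writerOf h (cT j)) (rowState-suc k<i)) (writer-target (accI j i) (rowState j i)))

      sr-value : ∀ {i j v} → InRange M N k i j → writerOf g (cA i j) ≡ just v → v ∈ predsF (srOf i j)
      sr-value {i} {j} r eq = pred-written (accI j i) (rowState j i) f (sr-ext r) (there (there (here refl)))
        (trans (rowState-A {j} {i}) eq)

      sr-input : ∀ {i j} → InRange M N k i j → writerOf g (cA i k) ≡ nothing →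
                 ∃[ u ] St.inNode (state f) (cA i k) ≡ just u × u ∈ predsF (srOf i j)
      sr-input {i} {j} r eq = pred-input (accI j i) (rowState j i) f (sr-ext r) (there (here refl))
        (trans (rowState-A {j} {i}) eq)

      record UpdateVertex (i j v : ℕ) : Set where
        field
          value-edge : ∀ {w} → writerOf g (cA i j) ≡ just w → w ∈ predsF v
          tau-edge   : stOf j ∈ predsF v
          computed   : St.inputOf (state f) v ≡ false
          v-size     : v < St.next (state f)

      -- `L₅` writes only column `k`, so the value that the iteration leaves in a column `j > k` is
      -- the one from `L₄`. Its operands are traced back through the blocks that do not write them.
      update-vertex : ∀ {i j v} → InRange M N k i j → writerOf g₅ (cA i j) ≡ just v → UpdateVertex i j v
      update-vertex {i} {j} r@(inRange k<i _ k<j j<N) eq with just-injective (trans (sym eq)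
          (trans (writer-grun L₅ g₄ (L₅-noA (<⇒≢ k<j))) (Visit.target-after (update-visit r))))
      ... | refl = record
        { value-edge = λ e → pred-written (updI j i) before f ext′ (here refl)
                         (trans target-before (trans (g₃-A (inj₁ (<⇒≢ k<i))) e))
        ; tau-edge   = pred-written (updI j i) before f ext′ (there (there (here refl)))
                         (trans (other-before L₄-noT) (trans (writer-grun L₃ g₂ L₃-noT) (proj₁ (stOf-writer k<j j<N))))
        ; computed   = vertex-input (updI j i) before f ext′
        ; v-size     = vertex-< (updI j i) before f ext′ }
        where
        open Visit (update-visit r)
        ext′ : gexec (updI j i) before ⊑ f
        ext′ = Extends-trans after-⊑ (Extends-trans (grun-⊑ L₅ g₄) ext)

      left-input : ∀ {i v} → k < i → i < M → writerOf g₅ (cA i k) ≡ just v → writerOf g (cA i k) ≡ nothing →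
                   ∃[ u ] St.inNode (state f) (cA i k) ≡ just u × u ∈ predsF v
      left-input {i} k<i i<M eq e with just-injective (trans (sym eq) (Visit.target-after (left-visit k<i i<M)))
      ... | refl = pred-input (leftI i) before f (Extends-trans after-⊑ ext) (here refl)
        (trans target-before (trans (writer-grun L₄ g₃ (L₄-noA ≤-refl)) (trans (g₃-A (inj₁ (<⇒≢ k<i))) e)))
        where open Visit (left-visit k<i i<M)

-- The CDAG of the whole program

cdagOf : St → CDAG
cdagOf s = record { size = St.next s ; preds = St.predsOf s ; isInput = St.inputOf s }

module Graph (M N : ℕ) where

  initial : Labelled
  initial = record
    { state = st₀
    ; lab   = λ _ → 0 , cT 0
    ; wf    = record { writer-< = λ () ; inNode-< = λ () ; inNode-lab = λ () ; inNode-input = λ () ; input-preds = λ () } }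

  open Program M N using (module After)
  open After using (g₅)

  -- Counting finished iterations gives structural recursion although the loop index decreases.
  afterSteps : ℕ → Labelled
  afterSteps zero    = initial
  afterSteps (suc d) = g₅ (N ∸ suc d) (afterSteps d)

  -- The state in which the iterations t - 1, …, 0 remain to be executed.
  remaining : ℕ → Labelled
  remaining t = afterSteps (N ∸ t)

  final : Labelled
  final = remaining 0

  remaining-step : ∀ {k} → k < N → remaining k ≡ g₅ k (remaining (suc k))
  remaining-step {k} k<N = trans (cong afterSteps eq)
    (cong (λ t → g₅ t (remaining (suc k))) (trans (cong (N ∸_) (sym eq)) (m∸[m∸n]≡n (<⇒≤ k<N))))
    where
    eq : N ∸ k ≡ suc (N ∸ suc k)
    eq = +-∸-assoc 1 k<N

  remaining-⊑ : ∀ {t} → t ≤ N → remaining t ⊑ final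
  remaining-⊑ {zero}  _   = Extends-refl
  remaining-⊑ {suc k} k<N = Extends-trans (After.g⊑ k (remaining (suc k)))
    (subst (_⊑ final) (remaining-step k<N) (remaining-⊑ (<⇒≤ k<N)))

  after-⊑ : ∀ {k} → k < N → g₅ k (remaining (suc k)) ⊑ final
  after-⊑ k<N = subst (_⊑ final) (remaining-step k<N) (remaining-⊑ (<⇒≤ k<N))

  state-final : state final ≡ program M N st₀
  state-final = sym (trans (cong (λ d → program M N (state (afterSteps d))) (sym (n∸n≡0 N))) (go ≤-refl))
    where
    go : ∀ {t} → t ≤ N → forEach (downFrom t) (body M N) (state (remaining t)) ≡ state final
    go {zero}  _   = refl
    go {suc k} k<N = trans (cong (forEach (downFrom k) (body M N))
      (trans (sym (After.state-after k (remaining (suc k)))) (cong state (sym (remaining-step k<N))))) (go (<⇒≤ k<N))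

  -- Iterations `N - 1` down to `t` write only columns of A from `t` on. In particular, column `k`
  -- still holds its inputs when iteration `k` begins.
  untouched : ∀ {t i j} → t ≤ N → j < t → writerOf (remaining t) (cA i j) ≡ nothing
  untouched {t} {i} {j} t≤N j<t = go (N ∸ t) (subst (j <_) (sym (m∸[m∸n]≡n t≤N)) j<t)
    where
    go : ∀ d → j < N ∸ d → writerOf (afterSteps d) (cA i j) ≡ nothing
    go zero    _  = refl
    go (suc d) j< = trans (After.unwritten (N ∸ suc d) (afterSteps d) j<) (go d (<-≤-trans j< (∸-monoʳ-≤ N (n≤1+n d))))

  -- Within the index ranges of the program the default `0` in `value` and `inp` does not occur, by
  -- `value-current` and `inp-left`.
  value sr : ℕ → ℕ → ℕ → ℕ
  value k i j = fromMaybe 0 (writerOf (remaining k) (cA i j))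
  sr k        = After.srOf k (remaining (suc k))

  st inp : ℕ → ℕ → ℕ
  st k    = After.stOf k (remaining (suc k))
  inp i k = fromMaybe 0 (St.inNode (state final) (cA i k))

  value-current : ∀ {k i j} → k ≤ i → i < M → k ≤ j → j < N →
                  writerOf (remaining k) (cA i j) ≡ just (value k i j) × lab (remaining k) (value k i j) ≡ (k , cA i j)
  value-current {k} {i} {j} k≤i i<M k≤j j<N
    with subst (Current k (cA i j)) (sym (remaining-step (≤-<-trans k≤j j<N)))
           (After.current-after k (remaining (suc k)) k≤i i<M k≤j j<N)
  ... | v , eq , eql with cong (fromMaybe 0) eq
  ...   | eqv = trans eq (cong just (sym eqv)) , trans (cong (lab (remaining k)) eqv) eql

  value-after : ∀ {k i j} → k ≤ i → i < M → k ≤ j → j < N →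
                writerOf (g₅ k (remaining (suc k))) (cA i j) ≡ just (value k i j)
  value-after {k} {i} {j} k≤i i<M k≤j j<N = trans
    (cong (λ g → writerOf g (cA i j)) (sym (remaining-step (≤-<-trans k≤j j<N))))
    (proj₁ (value-current k≤i i<M k≤j j<N))

  value-before : ∀ {k i j} → InRange M N k i j → writerOf (remaining (suc k)) (cA i j) ≡ just (value (suc k) i j)
  value-before (inRange k<i i<M k<j j<N) = proj₁ (value-current k<i i<M k<j j<N)

  -- A cell has at most one input node, so the accumulations and the last assignment to A[i][k] all
  -- read the same vertex.
  inp-pred : ∀ {i k} {us : List ℕ} → ∃[ u ] St.inNode (state final) (cA i k) ≡ just u × u ∈ us →
             St.inNode (state final) (cA i k) ≡ just (inp i k) × inp i k ∈ us
  inp-pred {us = us} (u , eq , u∈) with cong (fromMaybe 0) eq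
  ... | equ = trans eq (cong just (sym equ)) , subst (_∈ us) (sym equ) u∈

  inp-left : ∀ {k i} → k < i → i < M → k < N →
             St.inNode (state final) (cA i k) ≡ just (inp i k) × inp i k ∈ St.predsOf (state final) (value k i k)
  inp-left {k} k<i i<M k<N = inp-pred (After.Edges.left-input k (remaining (suc k)) {final} (after-⊑ k<N) k<i i<M
    (value-after (<⇒≤ k<i) i<M ≤-refl k<N) (untouched k<N ≤-refl))

  hourglass : Hourglass (cdagOf (state final)) M N
  hourglass = record
    { V = value ; sr = sr ; st = st ; inp = inp ; lab = lab final
    ; V-prev  = λ r → After.Edges.UpdateVertex.value-edge (update r) (value-before r)
    ; V-st    = λ r → After.Edges.UpdateVertex.tau-edge (update r)
    ; st-sr   = λ {k} r → After.Edges.st-edge k (remaining (suc k)) {final} (ext r) r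
    ; sr-prev = λ {k} r → After.Edges.sr-edge k (remaining (suc k)) {final} (ext r) r
    ; sr-V    = λ {k} r → After.Edges.sr-value k (remaining (suc k)) {final} (ext r) r (value-before r)
    ; sr-inp  = λ {k} r → proj₂ (inp-pred (After.Edges.sr-input k (remaining (suc k)) {final} (ext r) r (untouched (k<N r) ≤-refl)))
    ; V-inp       = λ k<i i<M k<N → proj₂ (inp-left k<i i<M k<N)
    ; inp-isInput = λ k<i i<M k<N → Wf.inNode-input (Labelled.wf final) (proj₁ (inp-left k<i i<M k<N))
    ; V-isInput   = λ r → After.Edges.UpdateVertex.computed (update r)
    ; V-size      = λ r → After.Edges.UpdateVertex.v-size (update r)
    ; lab-V       = λ {k} {i} {j} k≤i i<M k≤j j<N → let (eq , eql) = value-current {k} {i} {j} k≤i i<M k≤j j<N in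
        trans (Extends.lab-same (remaining-⊑ (<⇒≤ (≤-<-trans k≤j j<N))) (Wf.writer-< (Labelled.wf (remaining k)) eq)) eql
    ; lab-inp     = λ k<i i<M k<N → Wf.inNode-lab (Labelled.wf final) (proj₁ (inp-left k<i i<M k<N))
    ; input-preds = Wf.input-preds (Labelled.wf final) }
    where
    k<N : ∀ {k i j} → InRange M N k i j → k < N
    k<N (inRange _ _ k<j j<N) = <-trans k<j j<N
    ext : ∀ {k i j} → InRange M N k i j → g₅ k (remaining (suc k)) ⊑ final
    ext r = after-⊑ (k<N r)
    update : ∀ {k i j} (r : InRange M N k i j) →
             After.Edges.UpdateVertex k (remaining (suc k)) {final} (ext r) i j (value k i j)
    update {k} r@(inRange k<i i<M k<j j<N) = After.Edges.update-vertex k (remaining (suc k)) {final} (ext r) r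
      (value-after (<⇒≤ k<i) i<M (<⇒≤ k<j) j<N)

v2q-hourglass : ∀ M N → Hourglass (v2qCDAG M N) M N
v2q-hourglass M N = subst (λ s → Hourglass (cdagOf s) M N) (Graph.state-final M N) (Graph.hourglass M N)

theorem5 : (M N S : ℕ) → 1 ≤ N → N < M → 1 ≤ S →
    (ms : List Move) → CompleteGame (v2qCDAG M N) S ms →
    N * (N ∸ 1) * (3 * M ∸ N ∸ 1) * (M ∸ N) ^ 2
    ≤ 24 * ((M ∸ N) ^ 2 + S * M) * loads ms
theorem5 M N S _ N<M 1≤S ms game = hourglass-bound N<M 1≤S (v2q-hourglass M N) game
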